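{- Let $n\ge 6$ and $k$ be integers with $3\le k\le n-3$. Then for every integer $m\ge 2$, \[ \mathsf{BO}(k,\mathbb{Z}/n\mathbb{Z})\ge \frac{1}{m}\left(\frac{(n/k)^{1/m}-k}{k-1}\right)^{m-2}. \]
   Context: For a positive integer $k$, a set $\{g_1,\dots,g_k\}$ of $k$ distinct elements of a finite abelian group $G$ (written additively) is called $k$-barycentric if $\sum_{i=1}^k g_i = k\,g_j$ for some $1\le j\le k$. The $k$-th barycentric Olson constant $\mathsf{BO}(k,G)$ is the smallest integer $\ell$ such that every subset $A\subseteq G$ with $|A|\ge \ell$ contains a $k$-barycentric subset (so that always $\mathsf{BO}(k,G)\le |G|+1$). -}

module Defs where

open import Algebra.Bundles using (AbelianGroup; CommutativeRing; RawMonoid)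
import Algebra.Definitions.RawMonoid as RawMonoidDefs
import Algebra.Properties.CommutativeMonoid.Sum as CommutativeMonoidSum
open import Data.Bool.Base using (if_then_else_)
open import Data.Fin.Base as Fin using (Fin; toℕ)
import Data.Fin.Properties as Fin
open import Data.Fin.Subset using (Subset; _∈_; _⊆_; ∣_∣)
open import Data.Fin.Subset.Properties using (_∈?_; _⊆?_; anySubset?; ∣p∣≤n)
open import Data.Integer.Base as ℤ using (+_; -[1+_])
import Data.Integer.Properties as ℤ
import Data.Integer.Solver as ℤSolver
open import Data.Nat.Base as ℕ using (ℕ; zero; suc; NonZero; z≤n; s≤s)
open import Data.Nat.DivMod using (_%_; _mod_; m%n<n; m<n⇒m%n≡m; n%n≡0; %-distribˡ-+; m%n%n≡m%n)
import Data.Nat.Properties as ℕ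
open import Data.Product.Base using (Σ; ∃; _×_; _,_; proj₁; proj₂)
open import Data.Rational.Base as ℚ using (ℚ; 0ℚ; 1ℚ)
import Data.Rational.Properties as ℚ
import Data.Rational.Unnormalised.Base as ℚᵘ
import Data.Rational.Unnormalised.Properties as ℚᵘ
open import Data.Rational.Solver using (module +-*-Solver)
open import Data.Sum.Base using (inj₁; inj₂)
open import Data.Vec.Base using (lookup)
open import Function.Base using (_∘_)
open import Function.Bundles using (Inverse)
open import Function.Construct.Identity using () renaming (inverse to id-inverse)
open import Level using (Level; 0ℓ) renaming (suc to lsuc; _⊔_ to _⊔ˡ_)
open import Relation.Binary.Definitions using (Decidable)
open import Relation.Binary.PropositionalEquality
  using (_≡_; refl; sym; trans; cong; cong₂; subst; subst₂; isEquivalence; setoid; module ≡-Reasoning)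
open import Relation.Nullary using (Dec; yes; no; ¬_; contradiction)
open import Relation.Nullary.Decidable using (map′; ¬?; _×-dec_; _→-dec_; decidable-stable)
open import Relation.Unary using (Pred) renaming (Decidable to Decidable₁)

least : ∀ {p} {P : Pred ℕ p} → Decidable₁ P → ∀ b → P b →
        ∃ λ ℓ → P ℓ × (∀ m → P m → ℓ ℕ.≤ m)
least P? zero    Pb = zero , Pb , λ _ _ → z≤n
least {P = P} P? (suc b) Pb with P? zero
... | yes P0 = zero , P0 , λ _ _ → z≤n
... | no ¬P0 with least (P? ∘ suc) b Pb
...   | ℓ , Pℓ , min = suc ℓ , Pℓ , min′
  where
  min′ : ∀ m → P m → suc ℓ ℕ.≤ m
  min′ zero    P0 = contradiction P0 ¬P0
  min′ (suc m) Pm = s≤s (min m Pm)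

-- Searches downwards from b, so the a found is the largest one below b with P a.
greatest : ∀ {p} {P : Pred ℕ p} → Decidable₁ P → P 0 → ∀ b → ¬ P b →
           ∃ λ a → P a × ¬ P (suc a)
greatest P? P0 zero    ¬Pb = contradiction P0 ¬Pb
greatest P? P0 (suc b) ¬Pb with P? b
... | yes Pb  = b , Pb , ¬Pb
... | no ¬Pb′ = greatest P? P0 b ¬Pb′

record FiniteAbelianGroup c ℓ : Set (lsuc (c ⊔ˡ ℓ)) where
  field
    abelianGroup : AbelianGroup c ℓ
    order        : ℕ
    enumeration  : Inverse (AbelianGroup.setoid abelianGroup) (setoid (Fin order))

  open AbelianGroup abelianGroup public
    renaming (setoid to ≈-setoid; refl to ≈-refl; sym to ≈-sym; trans to ≈-trans)

  element : Fin order → Carrier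
  element = Inverse.from enumeration

  _≈?_ : Decidable _≈_
  x ≈? y = map′
    (λ eq → ≈-trans (≈-sym (Inverse.strictlyInverseʳ enumeration x))
             (≈-trans (Inverse.from-cong enumeration eq)
                      (Inverse.strictlyInverseʳ enumeration y)))
    (Inverse.to-cong enumeration)
    (Inverse.to enumeration x Fin.≟ Inverse.to enumeration y)

-- A subset of G is given by the set of indices of its elements, so that
-- distinct indices stand for distinct elements of G.
module _ {c ℓ} (G : FiniteAbelianGroup c ℓ) where
  open FiniteAbelianGroup G
  open RawMonoidDefs rawMonoid using () renaming (_×_ to _·_)
  open CommutativeMonoidSum commutativeMonoid using (sum)

  ∑ : Subset order → Carrier
  ∑ S = sum λ i → if lookup S i then element i else ε

  Barycentric : ℕ → Subset order → Set ℓ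
  Barycentric k S = ∣ S ∣ ≡ k × ∃ λ j → j ∈ S × ∑ S ≈ k · element j

  BOProperty : ℕ → ℕ → Set ℓ
  BOProperty k l =
    (A : Subset order) → l ℕ.≤ ∣ A ∣ → ∃ λ S → S ⊆ A × Barycentric k S

  Barycentric? : ∀ k → Decidable₁ (Barycentric k)
  Barycentric? k S =
    (∣ S ∣ ℕ.≟ k) ×-dec Fin.any? (λ j → (j ∈? S) ×-dec (∑ S ≈? (k · element j)))

  BOProperty? : ∀ k → Decidable₁ (BOProperty k)
  BOProperty? k l = map′
    (λ ¬∃ A → decidable-stable (Q? A) λ ¬q → ¬∃ (A , ¬q))
    (λ all (A , ¬q) → ¬q (all A))
    (¬? (anySubset? (¬? ∘ Q?)))
    where
    Q? : Decidable₁ λ A → l ℕ.≤ ∣ A ∣ → ∃ λ S → S ⊆ A × Barycentric k S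
    Q? A = (l ℕ.≤? ∣ A ∣) →-dec anySubset? (λ S → (S ⊆? A) ×-dec Barycentric? k S)

  -- No subset has order + 1 elements, so order + 1 has the property vacuously.
  BO-search : ∀ k → ∃ λ l → BOProperty k l × (∀ m → BOProperty k m → l ℕ.≤ m)
  BO-search k = least (BOProperty? k) (suc order)
    λ A l≤∣A∣ → contradiction (∣p∣≤n A) (ℕ.<⇒≱ l≤∣A∣)

BO : ∀ {c ℓ} → ℕ → FiniteAbelianGroup c ℓ → ℕ
BO k G = proj₁ (BO-search G k)

module _ {c ℓ} (k : ℕ) (G : FiniteAbelianGroup c ℓ) where

  BO-property : BOProperty G k (BO k G)
  BO-property = proj₁ (proj₂ (BO-search G k))

  BO-minimal : ∀ l → BOProperty G k l → BO k G ℕ.≤ l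
  BO-minimal = proj₂ (proj₂ (BO-search G k))

module _ (n : ℕ) .{{_ : NonZero n}} where
  private
    toℕ-mod : ∀ a → toℕ (a mod n) ≡ a % n
    toℕ-mod a = Fin.toℕ-fromℕ< (m%n<n a n)

    toℕ-% : (i : Fin n) → toℕ i % n ≡ toℕ i
    toℕ-% i = m<n⇒m%n≡m (Fin.toℕ<n i)

    %-congˡ : ∀ a b → (a % n ℕ.+ b) % n ≡ (a ℕ.+ b) % n
    %-congˡ a b = begin
      (a % n ℕ.+ b) % n          ≡⟨ %-distribˡ-+ (a % n) b n ⟩
      (a % n % n ℕ.+ b % n) % n  ≡⟨ cong (λ x → (x ℕ.+ b % n) % n) (m%n%n≡m%n a n) ⟩
      (a % n ℕ.+ b % n) % n      ≡⟨ %-distribˡ-+ a b n ⟨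
      (a ℕ.+ b) % n              ∎
      where open ≡-Reasoning

    %-congʳ : ∀ a b → (a ℕ.+ b % n) % n ≡ (a ℕ.+ b) % n
    %-congʳ a b = begin
      (a ℕ.+ b % n) % n  ≡⟨ cong (_% n) (ℕ.+-comm a (b % n)) ⟩
      (b % n ℕ.+ a) % n  ≡⟨ %-congˡ b a ⟩
      (b ℕ.+ a) % n      ≡⟨ cong (_% n) (ℕ.+-comm b a) ⟩
      (a ℕ.+ b) % n      ∎
      where open ≡-Reasoning

  addMod : Fin n → Fin n → Fin n
  addMod i j = (toℕ i ℕ.+ toℕ j) mod n

  zeroMod : Fin n
  zeroMod = 0 mod n

  negMod : Fin n → Fin n
  negMod i = (n ℕ.∸ toℕ i) mod n

  private
    toℕ-add : ∀ i j → toℕ (addMod i j) ≡ (toℕ i ℕ.+ toℕ j) % n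
    toℕ-add i j = toℕ-mod (toℕ i ℕ.+ toℕ j)

    add-assoc : ∀ i j l → addMod (addMod i j) l ≡ addMod i (addMod j l)
    add-assoc i j l = Fin.toℕ-injective (begin
      toℕ (addMod (addMod i j) l)            ≡⟨ toℕ-add (addMod i j) l ⟩
      (toℕ (addMod i j) ℕ.+ toℕ l) % n       ≡⟨ cong (λ x → (x ℕ.+ toℕ l) % n) (toℕ-add i j) ⟩
      ((toℕ i ℕ.+ toℕ j) % n ℕ.+ toℕ l) % n  ≡⟨ %-congˡ (toℕ i ℕ.+ toℕ j) (toℕ l) ⟩
      (toℕ i ℕ.+ toℕ j ℕ.+ toℕ l) % n        ≡⟨ cong (_% n) (ℕ.+-assoc (toℕ i) (toℕ j) (toℕ l)) ⟩
      (toℕ i ℕ.+ (toℕ j ℕ.+ toℕ l)) % n      ≡⟨ %-congʳ (toℕ i) (toℕ j ℕ.+ toℕ l) ⟨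
      (toℕ i ℕ.+ (toℕ j ℕ.+ toℕ l) % n) % n  ≡⟨ cong (λ x → (toℕ i ℕ.+ x) % n) (toℕ-add j l) ⟨
      (toℕ i ℕ.+ toℕ (addMod j l)) % n       ≡⟨ toℕ-add i (addMod j l) ⟨
      toℕ (addMod i (addMod j l))            ∎)
      where open ≡-Reasoning

    add-comm : ∀ i j → addMod i j ≡ addMod j i
    add-comm i j = cong (_mod n) (ℕ.+-comm (toℕ i) (toℕ j))

    add-identityʳ : ∀ i → addMod i zeroMod ≡ i
    add-identityʳ i = Fin.toℕ-injective (begin
      toℕ (addMod i zeroMod)       ≡⟨ toℕ-add i zeroMod ⟩
      (toℕ i ℕ.+ toℕ zeroMod) % n  ≡⟨ cong (λ x → (toℕ i ℕ.+ x) % n) (toℕ-mod 0) ⟩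
      (toℕ i ℕ.+ 0 % n) % n        ≡⟨ %-congʳ (toℕ i) 0 ⟩
      (toℕ i ℕ.+ 0) % n            ≡⟨ cong (_% n) (ℕ.+-identityʳ (toℕ i)) ⟩
      toℕ i % n                    ≡⟨ toℕ-% i ⟩
      toℕ i                        ∎)
      where open ≡-Reasoning

    add-inverseʳ : ∀ i → addMod i (negMod i) ≡ zeroMod
    add-inverseʳ i = Fin.toℕ-injective (begin
      toℕ (addMod i (negMod i))            ≡⟨ toℕ-add i (negMod i) ⟩
      (toℕ i ℕ.+ toℕ (negMod i)) % n       ≡⟨ cong (λ x → (toℕ i ℕ.+ x) % n) (toℕ-mod (n ℕ.∸ toℕ i)) ⟩
      (toℕ i ℕ.+ (n ℕ.∸ toℕ i) % n) % n    ≡⟨ %-congʳ (toℕ i) (n ℕ.∸ toℕ i) ⟩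
      (toℕ i ℕ.+ (n ℕ.∸ toℕ i)) % n        ≡⟨ cong (_% n) (ℕ.m+[n∸m]≡n (ℕ.<⇒≤ (Fin.toℕ<n i))) ⟩
      n % n                                ≡⟨ n%n≡0 n ⟩
      0                                    ≡⟨ m<n⇒m%n≡m (ℕ.>-nonZero⁻¹ n) ⟨
      0 % n                                ≡⟨ toℕ-mod 0 ⟨
      toℕ zeroMod                          ∎)
      where open ≡-Reasoning

  ℤ/-abelianGroup : AbelianGroup 0ℓ 0ℓ
  ℤ/-abelianGroup = record
    { Carrier = Fin n
    ; _≈_     = _≡_
    ; _∙_     = addMod
    ; ε       = zeroMod
    ; _⁻¹     = negMod
    ; isAbelianGroup = record
      { isGroup = record
        { isMonoid = record
          { isSemigroup = record
            { isMagma = record { isEquivalence = isEquivalence ; ∙-cong = cong₂ addMod }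
            ; assoc   = add-assoc
            }
          ; identity = (λ i → trans (add-comm zeroMod i) (add-identityʳ i)) , add-identityʳ
          }
        ; inverse = (λ i → trans (add-comm (negMod i) i) (add-inverseʳ i)) , add-inverseʳ
        ; ⁻¹-cong = cong negMod
        }
      ; comm = add-comm
      }
    }

  ℤ/_ℤ : FiniteAbelianGroup 0ℓ 0ℓ
  ℤ/_ℤ = record
    { abelianGroup = ℤ/-abelianGroup
    ; order        = n
    ; enumeration  = id-inverse (setoid (Fin n))
    }

open RawMonoidDefs ℚ.*-1-rawMonoid using () renaming (_×_ to pow)

infixr 8 _^ℚ_
_^ℚ_ : ℚ → ℕ → ℚ
p ^ℚ n = pow n p

0≤fraction : ∀ n d .{{_ : NonZero d}} → 0ℚ ℚ.≤ + n ℚ./ d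
0≤fraction n d = ℚ.nonNegative⁻¹ (+ n ℚ./ d) {{ℚ.normalize-nonNeg n d}}

private
  open import Data.Rational.Base using (_+_; _*_; _-_; -_; _≤_; _<_; _/_)

  <⇒≱ : ∀ {p q} → p < q → ¬ q ≤ p
  <⇒≱ p<q q≤p = ℚ.<-irrefl refl (ℚ.<-≤-trans p<q q≤p)

  +ε-≤ : ∀ p {e} → 0ℚ ≤ e → p ≤ p + e
  +ε-≤ p {e} 0≤e = subst (_≤ p + e) (ℚ.+-identityʳ p) (ℚ.+-monoʳ-≤ p 0≤e)

  *-mono : ∀ {p q r s} → 0ℚ ≤ p → p ≤ q → 0ℚ ≤ r → r ≤ s → p * r ≤ q * s
  *-mono {p} {q} {r} {s} 0≤p p≤q 0≤r r≤s = ℚ.≤-trans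
    (ℚ.*-monoʳ-≤-nonNeg r {{ℚ.nonNegative 0≤r}} p≤q)
    (ℚ.*-monoˡ-≤-nonNeg q {{ℚ.nonNegative (ℚ.≤-trans 0≤p p≤q)}} r≤s)

  *-nonNeg : ∀ {p q} → 0ℚ ≤ p → 0ℚ ≤ q → 0ℚ ≤ p * q
  *-nonNeg {p} {q} 0≤p 0≤q = subst (_≤ p * q) (ℚ.*-zeroʳ p)
    (ℚ.*-monoˡ-≤-nonNeg p {{ℚ.nonNegative 0≤p}} 0≤q)

  +-nonNeg : ∀ {p q} → 0ℚ ≤ p → 0ℚ ≤ q → 0ℚ ≤ p + q
  +-nonNeg = ℚ.+-mono-≤

  0<1 : 0ℚ < 1ℚ
  0<1 = ℚ.positive⁻¹ 1ℚ

  0≤1 : 0ℚ ≤ 1ℚ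
  0≤1 = ℚ.<⇒≤ 0<1

  0<half : ∀ {e} → 0ℚ < e → 0ℚ < e * ℚ.½
  0<half {e} 0<e = subst (_< e * ℚ.½) (ℚ.*-zeroˡ ℚ.½) (ℚ.*-monoˡ-<-pos ℚ.½ 0<e)

  half+half : ∀ e → e * ℚ.½ + e * ℚ.½ ≡ e
  half+half e = trans (sym (ℚ.*-distribˡ-+ e ℚ.½ ℚ.½)) (ℚ.*-identityʳ e)

  divide : ∀ {e} p → 0ℚ < p → 0ℚ < e → ∃ λ d → 0ℚ < d × p * d ≡ e
  divide {e} p 0<p 0<e = e * 1/p , 0<e*1/p , eq
    where
    instance
      p-pos = ℚ.positive 0<p
      p-nz  = ℚ.pos⇒nonZero p
    1/p = ℚ.1/ p
    0<e*1/p : 0ℚ < e * 1/p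
    0<e*1/p = subst (_< e * 1/p) (ℚ.*-zeroˡ 1/p)
      (ℚ.*-monoˡ-<-pos 1/p {{ℚ.1/pos⇒pos p}} 0<e)
    eq : p * (e * 1/p) ≡ e
    eq = trans (solve 3 (λ a b c → a :* (b :* c) := b :* (a :* c)) refl p e 1/p)
      (trans (cong (e *_) (ℚ.*-inverseʳ p)) (ℚ.*-identityʳ e))
      where open +-*-Solver

  ^-nonNeg : ∀ {p} m → 0ℚ ≤ p → 0ℚ ≤ p ^ℚ m
  ^-nonNeg zero    0≤p = 0≤1
  ^-nonNeg (suc m) 0≤p = *-nonNeg 0≤p (^-nonNeg m 0≤p)

  ^-mono : ∀ {p q} m → 0ℚ ≤ p → p ≤ q → p ^ℚ m ≤ q ^ℚ m
  ^-mono zero    0≤p p≤q = ℚ.≤-refl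
  ^-mono (suc m) 0≤p p≤q = *-mono 0≤p p≤q (^-nonNeg m 0≤p) (^-mono m 0≤p p≤q)

  1≤^ : ∀ {p} m → 1ℚ ≤ p → 1ℚ ≤ p ^ℚ m
  1≤^ zero    1≤p = ℚ.≤-refl
  1≤^ (suc m) 1≤p = *-mono 0≤1 1≤p 0≤1 (1≤^ m 1≤p)

  p≤p^m : ∀ {p} m .{{_ : NonZero m}} → 1ℚ ≤ p → p ≤ p ^ℚ m
  p≤p^m {p} (suc m) 1≤p = subst (_≤ p ^ℚ suc m) (ℚ.*-identityʳ p)
    (*-mono (ℚ.≤-trans 0≤1 1≤p) ℚ.≤-refl 0≤1 (1≤^ m 1≤p))

  fromℚᵘ-+ : ∀ p q → ℚ.fromℚᵘ p + ℚ.fromℚᵘ q ≡ ℚ.fromℚᵘ (p ℚᵘ.+ q)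
  fromℚᵘ-+ p q = ℚ.toℚᵘ-injective (begin
    ℚ.toℚᵘ (ℚ.fromℚᵘ p + ℚ.fromℚᵘ q)                 ≈⟨ ℚ.toℚᵘ-homo-+ (ℚ.fromℚᵘ p) (ℚ.fromℚᵘ q) ⟩
    ℚ.toℚᵘ (ℚ.fromℚᵘ p) ℚᵘ.+ ℚ.toℚᵘ (ℚ.fromℚᵘ q)     ≈⟨ ℚᵘ.+-cong (ℚ.toℚᵘ-fromℚᵘ p) (ℚ.toℚᵘ-fromℚᵘ q) ⟩
    p ℚᵘ.+ q                                         ≈⟨ ℚ.toℚᵘ-fromℚᵘ (p ℚᵘ.+ q) ⟨
    ℚ.toℚᵘ (ℚ.fromℚᵘ (p ℚᵘ.+ q))                     ∎)
    where
    open import Relation.Binary.Reasoning.Setoid ℚᵘ.≃-setoid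

  suc/ : ∀ a j → + suc a / suc j ≡ + a / suc j + + 1 / suc j
  suc/ a j = sym (trans (fromℚᵘ-+ (ℚᵘ.mkℚᵘ (+ a) j) (ℚᵘ.mkℚᵘ (+ 1) j))
    (ℚ.fromℚᵘ-cong {ℚᵘ.mkℚᵘ (+ a) j ℚᵘ.+ ℚᵘ.mkℚᵘ (+ 1) j} {ℚᵘ.mkℚᵘ (+ suc a) j}
      (ℚᵘ.*≡* (solve 2 (λ x d → (x :* d :+ con (+ 1) :* d) :* d
                               := (con (+ 1) :+ x) :* (d :* d))
                 refl (+ a) (+ suc j)))))
    where open ℤSolver.+-*-Solver

  i≤∣i∣ : ∀ i → i ℤ.≤ + ℤ.∣ i ∣
  i≤∣i∣ (+ _)    = ℤ.≤-refl
  i≤∣i∣ -[1+ _ ] = ℤ.-≤+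

  p<suc∣↥p∣ : ∀ p → p < + suc ℤ.∣ ℚ.↥ p ∣ / 1
  p<suc∣↥p∣ (ℚ.mkℚ n d _) = ℚ.toℚᵘ-cancel-< (ℚᵘ.<-≤-trans (ℚᵘ.*<* lt)
    (ℚᵘ.≤-reflexive (ℚᵘ.≃-sym (ℚ.toℚᵘ-fromℚᵘ (ℚᵘ.mkℚᵘ (+ suc ℤ.∣ n ∣) 0)))))
    where
    open ℤ.≤-Reasoning
    lt : n ℤ.* + 1 ℤ.< + suc ℤ.∣ n ∣ ℤ.* + suc d
    lt = begin-strict
      n ℤ.* + 1                 ≡⟨ ℤ.*-identityʳ n ⟩
      n                         ≤⟨ i≤∣i∣ n ⟩
      + ℤ.∣ n ∣                 <⟨ ℤ.+<+ (ℕ.n<1+n ℤ.∣ n ∣) ⟩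
      + suc ℤ.∣ n ∣             ≤⟨ ℤ.+≤+ (ℕ.m≤m*n (suc ℤ.∣ n ∣) (suc d)) ⟩
      + (suc ℤ.∣ n ∣ ℕ.* suc d) ≡⟨ ℤ.pos-* (suc ℤ.∣ n ∣) (suc d) ⟩
      + suc ℤ.∣ n ∣ ℤ.* + suc d ∎

  unit : ℕ → ℚ
  unit j = + 1 / suc j

  unit-antimono : ∀ {i j} → i ℕ.≤ j → unit j ≤ unit i
  unit-antimono {i} {j} i≤j = ℚ.toℚᵘ-cancel-≤ (ℚᵘ.≤-trans
    (ℚᵘ.≤-reflexive (ℚ.toℚᵘ-fromℚᵘ (ℚᵘ.mkℚᵘ (+ 1) j)))
    (ℚᵘ.≤-trans (ℚᵘ.*≤* (ℤ.*-monoˡ-≤-nonNeg (+ 1) (ℤ.+≤+ (s≤s i≤j))))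
      (ℚᵘ.≤-reflexive (ℚᵘ.≃-sym (ℚ.toℚᵘ-fromℚᵘ (ℚᵘ.mkℚᵘ (+ 1) i))))))

  archimedean : ∀ e → 0ℚ < e → ∃ λ N → unit N ≤ e
  archimedean (ℚ.mkℚ (+ zero) d _) 0<e = contradiction (ℚ.drop-*<* 0<e) λ { (ℤ.+<+ ()) }
  archimedean (ℚ.mkℚ -[1+ _ ] d _) 0<e = contradiction (ℚ.drop-*<* 0<e) λ ()
  archimedean (ℚ.mkℚ (+ suc a) d _) 0<e = d , ℚ.toℚᵘ-cancel-≤ (ℚᵘ.≤-trans
    (ℚᵘ.≤-reflexive (ℚ.toℚᵘ-fromℚᵘ (ℚᵘ.mkℚᵘ (+ 1) d)))
    (ℚᵘ.*≤* (ℤ.*-monoʳ-≤-nonNeg (+ suc d) {+ 1} {+ suc a} (ℤ.+≤+ (s≤s z≤n)))))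

  unit≤1 : ∀ j → unit j ≤ 1ℚ
  unit≤1 j = unit-antimono {0} {j} z≤n

-- Real numbers are Cauchy sequences of rationals, compared by _≃ℝ_.
record ℝ : Set where
  constructor mkℝ
  field
    seq    : ℕ → ℚ
    cauchy : ∀ ε → 0ℚ ℚ.< ε →
             ∃ λ N → ∀ i j → N ℕ.≤ i → N ℕ.≤ j → ℚ.∣ seq i ℚ.- seq j ∣ ℚ.≤ ε

open ℝ public

infix 4 _≤ℝ_ _≃ℝ_

-- The Cauchy-sequence order: lim x ≤ lim y allows an error ε at every stage.
_≤ℝ_ : ℝ → ℝ → Set
x ≤ℝ y = ∀ ε → 0ℚ ℚ.< ε → ∃ λ N → ∀ i → N ℕ.≤ i → seq x i ℚ.≤ seq y i ℚ.+ ε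

_≃ℝ_ : ℝ → ℝ → Set
x ≃ℝ y = x ≤ℝ y × y ≤ℝ x

fromℚ : ℚ → ℝ
fromℚ q = mkℝ (λ _ → q) λ ε 0<ε → 0 , λ _ _ _ _ →
  subst (ℚ._≤ ε) (sym (cong ℚ.∣_∣ (ℚ.+-inverseʳ q))) (ℚ.<⇒≤ 0<ε)

fromℕ : ℕ → ℝ
fromℕ n = fromℚ (+ n ℚ./ 1)

infixl 6 _+ℝ_ _-ℝ_
infixl 7 _*ℝ_ _÷ℝ_
infixr 8 _^ℝ_
infix  8 -ℝ_

_+ℝ_ : ℝ → ℝ → ℝ
mkℝ x cx +ℝ mkℝ y cy = mkℝ (λ i → x i ℚ.+ y i) c
  where
  c : ∀ ε → _ → _
  c ε 0<ε with cx (ε * ℚ.½) (0<half 0<ε) | cy (ε * ℚ.½) (0<half 0<ε)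
  ... | M , hx | N , hy = M ℕ.⊔ N , λ i j h₁ h₂ → begin
    ℚ.∣ x i + y i - (x j + y j) ∣
      ≡⟨ cong ℚ.∣_∣ (solve 4 (λ a b c d → a :+ b :- (c :+ d) := (a :- c) :+ (b :- d)) refl (x i) (y i) (x j) (y j)) ⟩
    ℚ.∣ (x i - x j) + (y i - y j) ∣
      ≤⟨ ℚ.∣p+q∣≤∣p∣+∣q∣ (x i - x j) (y i - y j) ⟩
    ℚ.∣ x i - x j ∣ + ℚ.∣ y i - y j ∣
      ≤⟨ ℚ.+-mono-≤ (hx i j (ℕ.m⊔n≤o⇒m≤o M N h₁) (ℕ.m⊔n≤o⇒m≤o M N h₂))
                    (hy i j (ℕ.m⊔n≤o⇒n≤o M N h₁) (ℕ.m⊔n≤o⇒n≤o M N h₂)) ⟩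
    ε * ℚ.½ + ε * ℚ.½
      ≡⟨ half+half ε ⟩
    ε ∎
    where
    open ℚ.≤-Reasoning
    open +-*-Solver

-ℝ_ : ℝ → ℝ
-ℝ mkℝ x cx = mkℝ (λ i → ℚ.- x i) c
  where
  c : ∀ ε → _ → _
  c ε 0<ε with cx ε 0<ε
  ... | N , hx = N , λ i j h₁ h₂ → subst (ℚ._≤ ε)
    (trans (sym (ℚ.∣-p∣≡∣p∣ (x i ℚ.- x j))) (cong ℚ.∣_∣ (ℚ.neg-distrib-+ (x i) (ℚ.- x j))))
    (hx i j h₁ h₂)

_-ℝ_ : ℝ → ℝ → ℝ
x -ℝ y = x +ℝ (-ℝ y)

private
  eventual-bound : (x : ℝ) → ∃ λ B → ∃ λ N →
    0ℚ ℚ.< B × (∀ i → N ℕ.≤ i → ℚ.∣ seq x i ∣ ℚ.≤ B)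
  eventual-bound (mkℝ x cx) with cx 1ℚ 0<1
  ... | N , h = 1ℚ + ℚ.∣ x N ∣ , N , ℚ.+-mono-<-≤ 0<1 (ℚ.0≤∣p∣ (x N)) , λ i N≤i → begin
    ℚ.∣ x i ∣                    ≡⟨ cong ℚ.∣_∣ (solve 2 (λ a b → a := (a :- b) :+ b) refl (x i) (x N)) ⟩
    ℚ.∣ (x i - x N) + x N ∣      ≤⟨ ℚ.∣p+q∣≤∣p∣+∣q∣ (x i - x N) (x N) ⟩
    ℚ.∣ x i - x N ∣ + ℚ.∣ x N ∣  ≤⟨ ℚ.+-monoˡ-≤ ℚ.∣ x N ∣ (h i N N≤i ℕ.≤-refl) ⟩
    1ℚ + ℚ.∣ x N ∣               ∎
    where
    open ℚ.≤-Reasoning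
    open +-*-Solver

private
  *-difference : ∀ a b c d → a * b - c * d ≡ a * (b - d) + d * (a - c)
  *-difference = solve 4 (λ a b c d → a :* b :- c :* d := a :* (b :- d) :+ d :* (a :- c)) refl
    where open +-*-Solver

  *-close : ∀ a b c d A B δ → ℚ.∣ a ∣ ≤ A → ℚ.∣ d ∣ ≤ B →
            ℚ.∣ b - d ∣ ≤ δ → ℚ.∣ a - c ∣ ≤ δ → ℚ.∣ a * b - c * d ∣ ≤ (A + B) * δ
  *-close a b c d A B δ a≤A d≤B bd≤δ ac≤δ = begin
    ℚ.∣ a * b - c * d ∣                            ≡⟨ cong ℚ.∣_∣ (*-difference a b c d) ⟩
    ℚ.∣ a * (b - d) + d * (a - c) ∣                ≤⟨ ℚ.∣p+q∣≤∣p∣+∣q∣ (a * (b - d)) (d * (a - c)) ⟩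
    ℚ.∣ a * (b - d) ∣ + ℚ.∣ d * (a - c) ∣          ≡⟨ cong₂ _+_ (ℚ.∣p*q∣≡∣p∣*∣q∣ a (b - d)) (ℚ.∣p*q∣≡∣p∣*∣q∣ d (a - c)) ⟩
    ℚ.∣ a ∣ * ℚ.∣ b - d ∣ + ℚ.∣ d ∣ * ℚ.∣ a - c ∣  ≤⟨ ℚ.+-mono-≤ (*-mono (ℚ.0≤∣p∣ a) a≤A (ℚ.0≤∣p∣ (b - d)) bd≤δ)
                                                                  (*-mono (ℚ.0≤∣p∣ d) d≤B (ℚ.0≤∣p∣ (a - c)) ac≤δ) ⟩
    A * δ + B * δ                                  ≡⟨ ℚ.*-distribʳ-+ δ A B ⟨
    (A + B) * δ                                    ∎
    where open ℚ.≤-Reasoning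

_*ℝ_ : ℝ → ℝ → ℝ
x *ℝ y = mkℝ (λ i → seq x i ℚ.* seq y i) λ ε 0<ε →
  let
    A , K , 0<A , x≤A = eventual-bound x
    B , L , 0<B , y≤B = eventual-bound y
    δ , 0<δ , eq = divide (A ℚ.+ B) (ℚ.+-mono-< 0<A 0<B) 0<ε
    M , x-close = cauchy x δ 0<δ
    N , y-close = cauchy y δ 0<δ
    fst = ℕ.m⊔n≤o⇒m≤o
    snd = ℕ.m⊔n≤o⇒n≤o
  in (K ℕ.⊔ L) ℕ.⊔ (M ℕ.⊔ N) , λ i j h₁ h₂ → subst (_ ≤_) eq
    (*-close (seq x i) (seq y i) (seq x j) (seq y j) A B δ
      (x≤A i (fst K L (fst (K ℕ.⊔ L) (M ℕ.⊔ N) h₁)))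
      (y≤B j (snd K L (fst (K ℕ.⊔ L) (M ℕ.⊔ N) h₂)))
      (y-close i j (snd M N (snd (K ℕ.⊔ L) (M ℕ.⊔ N) h₁)) (snd M N (snd (K ℕ.⊔ L) (M ℕ.⊔ N) h₂)))
      (x-close i j (fst M N (snd (K ℕ.⊔ L) (M ℕ.⊔ N) h₁)) (fst M N (snd (K ℕ.⊔ L) (M ℕ.⊔ N) h₂))))

_÷ℝ_ : ℝ → (d : ℕ) → .{{_ : NonZero d}} → ℝ
x ÷ℝ d = x *ℝ fromℚ (+ 1 ℚ./ d)

_^ℝ_ : ℝ → ℕ → ℝ
x ^ℝ zero  = fromℕ 1
x ^ℝ suc m = x *ℝ x ^ℝ m

seq-^ℝ : ∀ x m i → seq (x ^ℝ m) i ≡ seq x i ^ℚ m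
seq-^ℝ x zero    i = refl
seq-^ℝ x (suc m) i = cong (λ z → seq x i ℚ.* z) (seq-^ℝ x m i)

-- The m-th root of a nonnegative rational q: its j-th approximation is the
-- largest multiple of 1 / (j + 1) whose m-th power is at most q.
-- root-nonNeg and root-^ state that it is the nonnegative real with m-th power q.
module _ (m : ℕ) .{{_ : NonZero m}} (q : ℚ) (0≤q : 0ℚ ℚ.≤ q) where
  private
    num : ℕ
    num = ℤ.∣ ℚ.↥ q ∣

    P : ℕ → ℕ → Set
    P j a = (+ a / suc j) ^ℚ m ≤ q

    P0 : ∀ j → P j 0
    P0 j = subst (λ z → z ^ℚ m ≤ q) (sym (ℚ.0/n≡0 (suc j))) (0^m m)
      where
      0^m : ∀ m .{{_ : NonZero m}} → 0ℚ ^ℚ m ≤ q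
      0^m (suc m) = subst (_≤ q) (sym (ℚ.*-zeroˡ (0ℚ ^ℚ m))) 0≤q

    top : ℕ → ℕ
    top j = suc num ℕ.* suc j

    top≡ : ∀ j → + top j / suc j ≡ + suc num / 1
    top≡ j = ℚ.fromℚᵘ-cong {ℚᵘ.mkℚᵘ (+ top j) j} {ℚᵘ.mkℚᵘ (+ suc num) 0}
      (ℚᵘ.*≡* (trans (ℤ.*-identityʳ (+ top j)) (ℤ.pos-* (suc num) (suc j))))

    1≤sucnum : 1ℚ ≤ + suc num / 1
    1≤sucnum = subst (1ℚ ≤_) (trans (ℚ.+-comm 1ℚ (+ num / 1)) (sym (suc/ num 0)))
      (+ε-≤ 1ℚ (0≤fraction num 1))

    ¬Ptop : ∀ j → ¬ P j (top j)
    ¬Ptop j le = <⇒≱ (p<suc∣↥p∣ q) (ℚ.≤-trans (p≤p^m m 1≤sucnum)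
      (subst (λ z → z ^ℚ m ≤ q) (top≡ j) le))

    search : ∀ j → ∃ λ a → P j a × ¬ P j (suc a)
    search j = greatest (λ a → (+ a / suc j) ^ℚ m ℚ.≤? q) (P0 j) (top j) (¬Ptop j)

  rootSeq : ℕ → ℚ
  rootSeq j = + proj₁ (search j) ℚ./ suc j

  rootSeq-nonNeg : ∀ j → 0ℚ ℚ.≤ rootSeq j
  rootSeq-nonNeg j = 0≤fraction (proj₁ (search j)) (suc j)

  rootSeq-lower : ∀ j → rootSeq j ^ℚ m ℚ.≤ q
  rootSeq-lower j = proj₁ (proj₂ (search j))

  rootSeq-upper : ∀ j → q ℚ.< (rootSeq j ℚ.+ + 1 ℚ./ suc j) ^ℚ m
  rootSeq-upper j = ℚ.≰⇒> (subst (λ z → ¬ (z ^ℚ m ≤ q)) (suc/ (proj₁ (search j)) j)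
    (proj₂ (proj₂ (search j))))

  private
    close : ∀ i j → rootSeq i ≤ rootSeq j + unit j
    close i j = ℚ.≮⇒≥ λ lt → <⇒≱ (rootSeq-upper j) (ℚ.≤-trans
      (^-mono m (+-nonNeg (rootSeq-nonNeg j) (0≤fraction 1 (suc j))) (ℚ.<⇒≤ lt))
      (rootSeq-lower i))

    diff-≤ : ∀ {a b e} → a ≤ b + e → a - b ≤ e
    diff-≤ {a} {b} {e} h = subst (a - b ≤_)
      (solve 2 (λ b e → b :+ e :- b := e) refl b e) (ℚ.+-monoˡ-≤ (ℚ.- b) h)
      where open +-*-Solver

    abs-≤ : ∀ {a b e} → a ≤ b + e → b ≤ a + e → ℚ.∣ a - b ∣ ≤ e
    abs-≤ {a} {b} {e} h₁ h₂ with ℚ.∣p∣≡p∨∣p∣≡-p (a - b)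
    ... | inj₁ eq = subst (_≤ e) (sym eq) (diff-≤ h₁)
    ... | inj₂ eq = subst (_≤ e)
      (sym (trans eq (solve 2 (λ a b → :- (a :- b) := b :- a) refl a b))) (diff-≤ h₂)
      where open +-*-Solver

  root : ℝ
  root = mkℝ rootSeq λ ε 0<ε → let N , uN≤ε = archimedean ε 0<ε in
    N , λ i j N≤i N≤j → abs-≤
      (ℚ.≤-trans (close i j) (ℚ.+-monoʳ-≤ (rootSeq j) (ℚ.≤-trans (unit-antimono N≤j) uN≤ε)))
      (ℚ.≤-trans (close j i) (ℚ.+-monoʳ-≤ (rootSeq i) (ℚ.≤-trans (unit-antimono N≤i) uN≤ε)))

  root-nonNeg : fromℕ 0 ≤ℝ root
  root-nonNeg ε 0<ε = 0 , λ i _ → +-nonNeg (rootSeq-nonNeg i) (ℚ.<⇒≤ 0<ε)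

  private
    B : ℚ
    B = q + 1ℚ

    0≤B : 0ℚ ≤ B
    0≤B = +-nonNeg 0≤q 0≤1

    rootSeq≤B : ∀ j → rootSeq j ≤ B
    rootSeq≤B j = ℚ.≮⇒≥ λ B<r → <⇒≱ B<r (ℚ.≤-trans
      (ℚ.≤-trans (p≤p^m m (ℚ.≤-trans 1≤B (ℚ.<⇒≤ B<r))) (rootSeq-lower j)) (+ε-≤ q 0≤1))
      where
      1≤B : 1ℚ ≤ B
      1≤B = subst (1ℚ ≤_) (ℚ.+-comm 1ℚ q) (+ε-≤ 1ℚ 0≤q)

    slope : ℕ → ℚ
    slope zero    = 0ℚ
    slope (suc l) = B ^ℚ l + B * slope l + slope l

    0≤slope : ∀ l → 0ℚ ≤ slope l
    0≤slope zero    = ℚ.≤-refl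
    0≤slope (suc l) = +-nonNeg (+-nonNeg (^-nonNeg l 0≤B) (*-nonNeg 0≤B (0≤slope l))) (0≤slope l)

    increment : ∀ l {r d} → 0ℚ ≤ r → r ≤ B → 0ℚ ≤ d → d ≤ 1ℚ →
                (r + d) ^ℚ l ≤ r ^ℚ l + d * slope l
    increment zero {r} {d} _ _ _ _ = ℚ.≤-reflexive
      (sym (trans (cong (λ z → 1ℚ + z) (ℚ.*-zeroʳ d)) (ℚ.+-identityʳ 1ℚ)))
    increment (suc l) {r} {d} 0≤r r≤B 0≤d d≤1 = begin
      (r + d) * (r + d) ^ℚ l
        ≤⟨ *-mono (+-nonNeg 0≤r 0≤d) ℚ.≤-refl (^-nonNeg l (+-nonNeg 0≤r 0≤d))
             (increment l 0≤r r≤B 0≤d d≤1) ⟩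
      (r + d) * (r ^ℚ l + d * s)
        ≡⟨ solve 4 (λ r d p s → (r :+ d) :* (p :+ d :* s)
                              := r :* p :+ d :* (p :+ r :* s :+ d :* s))
             refl r d (r ^ℚ l) s ⟩
      r * r ^ℚ l + d * (r ^ℚ l + r * s + d * s)
        ≤⟨ ℚ.+-monoʳ-≤ (r * r ^ℚ l) (ℚ.*-monoˡ-≤-nonNeg d {{ℚ.nonNegative 0≤d}}
             (ℚ.+-mono-≤ (ℚ.+-mono-≤ (^-mono l 0≤r r≤B)
               (*-mono 0≤r r≤B (0≤slope l) ℚ.≤-refl))
               (ℚ.≤-trans (*-mono 0≤d d≤1 (0≤slope l) ℚ.≤-refl) (ℚ.≤-reflexive (ℚ.*-identityˡ s))))) ⟩
      r * r ^ℚ l + d * (B ^ℚ l + B * s + s) ∎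
      where
      s = slope l
      open ℚ.≤-Reasoning
      open +-*-Solver

    rootSeq-gap : ∀ i δ → unit i ≤ δ → q ≤ rootSeq i ^ℚ m + (slope m + 1ℚ) * δ
    rootSeq-gap i δ u≤δ = begin
      q                                    ≤⟨ ℚ.<⇒≤ (rootSeq-upper i) ⟩
      (rootSeq i + unit i) ^ℚ m            ≤⟨ increment m (rootSeq-nonNeg i) (rootSeq≤B i) (0≤fraction 1 (suc i)) (unit≤1 i) ⟩
      rootSeq i ^ℚ m + unit i * slope m    ≤⟨ ℚ.+-monoʳ-≤ (rootSeq i ^ℚ m)
                                                (*-mono (0≤fraction 1 (suc i)) u≤δ (0≤slope m) (+ε-≤ (slope m) 0≤1)) ⟩
      rootSeq i ^ℚ m + δ * (slope m + 1ℚ)  ≡⟨ cong (λ z → rootSeq i ^ℚ m + z) (ℚ.*-comm δ (slope m + 1ℚ)) ⟩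
      rootSeq i ^ℚ m + (slope m + 1ℚ) * δ  ∎
      where open ℚ.≤-Reasoning

  root-^ : root ^ℝ m ≃ℝ fromℚ q
  root-^ = upper , lower
    where
    upper : root ^ℝ m ≤ℝ fromℚ q
    upper ε 0<ε = 0 , λ i _ → subst (λ z → z ≤ q + ε) (sym (seq-^ℝ root m i))
      (ℚ.≤-trans (rootSeq-lower i) (+ε-≤ q (ℚ.<⇒≤ 0<ε)))
    lower : fromℚ q ≤ℝ root ^ℝ m
    lower ε 0<ε =
      let
        δ , 0<δ , eq = divide (slope m + 1ℚ) (ℚ.+-mono-≤-< (0≤slope m) 0<1) 0<ε
        N , uN≤δ     = archimedean δ 0<δ
      in N , λ i N≤i → subst₂ (λ y z → q ≤ y + z) (sym (seq-^ℝ root m i)) eq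
           (rootSeq-gap i δ (ℚ.≤-trans (unit-antimono N≤i) uN≤δ))

{-# OPTIONS --safe #-}

-- Behrend's construction.  Let b be maximal with k b^m ≤ n, so that
-- b ≤ (n/k)^{1/m} < b + 1, and let (k − 1)h < b.  Among the numbers below b^m whose
-- base-b digits are all at most h, take those whose digit vectors have a fixed squared
-- norm.  Neither reduction modulo n nor carrying interferes with a barycentric equation
-- between such numbers, so it holds digitwise and exhibits a point of a sphere as the
-- barycentre of other points of that sphere, contradicting strict convexity.  The
-- (h + 1)^m digit vectors have fewer than m (h + 1)² norms, so by pigeonhole
-- BO(k, ℤ/nℤ) ≥ (h + 1)^{m−2}/m.  For h = ⌊(b − 1)/(k − 1)⌋ the number h + 1 bounds
-- |(n/k)^{1/m} − k|/(k − 1).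
module Submission where

open import Defs
open import Algebra.Bundles using (AbelianGroup)
import Algebra.Definitions.RawMonoid as RawMonoidDefs
import Algebra.Properties.CommutativeMonoid.Sum as CommutativeMonoidSum
import Algebra.Properties.Semiring.Sum as SemiringSum
open import Data.Bool.Base using (true; false; if_then_else_)
open import Data.Fin.Base using (Fin; zero; suc; toℕ; fromℕ<; combine; finToFun; funToFin)
import Data.Fin.Properties as Fin
open import Data.Fin.Subset using (Subset; _∈_; _∉_; _⊆_; ∣_∣; outside)
import Data.Integer.Properties as ℤ
open import Data.Nat.Base
open import Data.Nat.DivMod
open import Data.Nat.Divisibility using (divides-refl)
open import Data.Nat.Properties
open import Data.Nat.Solver using (module +-*-Solver)
open import Data.Product.Base using (∃; _×_; _,_; proj₁; proj₂)
open import Data.Rational.Base as ℚ using (ℚ; 0ℚ; 1ℚ; toℚᵘ)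
import Data.Rational.Properties as ℚ
import Data.Rational.Solver as ℚSolver
import Data.Rational.Unnormalised.Base as ℚᵘ
import Data.Rational.Unnormalised.Properties as ℚᵘ
open import Data.Sum.Base using (_⊎_; inj₁; inj₂)
open import Data.Vec.Base using ([]; _∷_; lookup; tabulate; here; there; _[_]≔_)
open import Data.Vec.Properties using ([]=⇒lookup; lookup⇒[]=; lookup∘tabulate)
open import Function.Base using (_∘_)
open import Relation.Binary.PropositionalEquality
open import Relation.Nullary using (Dec; yes; ¬_; does; contradiction)
open import Relation.Nullary.Decidable using (map′; _×-dec_; dec-true)

open SemiringSum +-*-semiring
  using (sum; sum-cong-≗; ∑-distrib-+; ∑-comm; *-distribˡ-sum; *-distribʳ-sum)

private variable
  m n r : ℕ

-- Inner products and squared distances of vectors over ℕ.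

sum-mono : {f g : Fin n → ℕ} → (∀ i → f i ≤ g i) → sum f ≤ sum g
sum-mono {zero}  f≤g = z≤n
sum-mono {suc n} f≤g = +-mono-≤ (f≤g zero) (sum-mono (f≤g ∘ suc))

sum-const : ∀ n c → sum {n} (λ _ → c) ≡ n * c
sum-const zero    c = refl
sum-const (suc n) c = cong (c +_) (sum-const n c)

term≤sum : (f : Fin n → ℕ) → ∀ i → f i ≤ sum f
term≤sum f zero    = m≤m+n (f zero) _
term≤sum f (suc i) = ≤-trans (term≤sum (f ∘ suc) i) (m≤n+m _ (f zero))

dot : (Fin m → ℕ) → (Fin m → ℕ) → ℕ
dot u v = sum λ e → u e * v e

dist² : (Fin m → ℕ) → (Fin m → ℕ) → ℕ
dist² u v = sum λ e → ∣ u e - v e ∣ * ∣ u e - v e ∣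

-- The binomial expansion of (a - b)², with the cross term moved to the left so that no truncated
-- subtraction occurs.
∣-∣²-expand : ∀ a b → ∣ a - b ∣ * ∣ a - b ∣ + 2 * (a * b) ≡ a * a + b * b
∣-∣²-expand a b with ≤-total a b
... | inj₁ a≤b with m≤n⇒∃[o]m+o≡n a≤b
...   | d , refl rewrite ∣m-m+n∣≡n a d =
  solve 2 (λ a d → d :* d :+ con 2 :* (a :* (a :+ d)) := a :* a :+ (a :+ d) :* (a :+ d)) refl a d
  where open +-*-Solver
∣-∣²-expand a b | inj₂ b≤a with m≤n⇒∃[o]m+o≡n b≤a
...   | d , refl rewrite ∣-∣-comm (b + d) b | ∣m-m+n∣≡n b d =
  solve 2 (λ b d → d :* d :+ con 2 :* ((b :+ d) :* b) := (b :+ d) :* (b :+ d) :+ b :* b) refl b d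
  where open +-*-Solver

dist²-expand : (u v : Fin m → ℕ) → dist² u v + 2 * dot u v ≡ dot u u + dot v v
dist²-expand u v = begin
  dist² u v + 2 * dot u v
    ≡⟨ cong (dist² u v +_) (*-distribˡ-sum 2 (λ e → u e * v e)) ⟩
  dist² u v + sum (λ e → 2 * (u e * v e))
    ≡⟨ ∑-distrib-+ (λ e → ∣ u e - v e ∣ * ∣ u e - v e ∣) (λ e → 2 * (u e * v e)) ⟨
  sum (λ e → ∣ u e - v e ∣ * ∣ u e - v e ∣ + 2 * (u e * v e))
    ≡⟨ sum-cong-≗ (λ e → ∣-∣²-expand (u e) (v e)) ⟩
  sum (λ e → u e * u e + v e * v e)
    ≡⟨ ∑-distrib-+ (λ e → u e * u e) (λ e → v e * v e) ⟩
  dot u u + dot v v ∎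
  where open ≡-Reasoning

dist²≡0⇒≗ : (u v : Fin m → ℕ) → dist² u v ≡ 0 → ∀ e → u e ≡ v e
dist²≡0⇒≗ u v d≡0 e with m*n≡0⇒m≡0∨n≡0 ∣ u e - v e ∣
  (n≤0⇒n≡0 (subst (_ ≤_) d≡0 (term≤sum (λ e → ∣ u e - v e ∣ * ∣ u e - v e ∣) e)))
... | inj₁ eq = ∣m-n∣≡0⇒m≡n eq
... | inj₂ eq = ∣m-n∣≡0⇒m≡n eq

-- Linearity of `dot` in its first argument: the sums over points and over coordinates are
-- exchanged.
weighted-dot : (w : Fin n → ℕ) (v : Fin n → Fin m → ℕ) (c : Fin m → ℕ) →
               sum (λ i → w i * dot (v i) c) ≡ dot (λ e → sum λ i → w i * v i e) c
weighted-dot w v c = begin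
  sum (λ i → w i * dot (v i) c)
    ≡⟨ sum-cong-≗ (λ i → trans (*-distribˡ-sum (w i) (λ e → v i e * c e))
                               (sum-cong-≗ λ e → sym (*-assoc (w i) (v i e) (c e)))) ⟩
  sum (λ i → sum λ e → w i * v i e * c e)
    ≡⟨ ∑-comm (λ i e → w i * v i e * c e) ⟩
  sum (λ e → sum λ i → w i * v i e * c e)
    ≡⟨ sum-cong-≗ (λ e → *-distribʳ-sum (c e) (λ i → w i * v i e)) ⟨
  dot (λ e → sum λ i → w i * v i e) c ∎
  where open ≡-Reasoning

-- The squared distances to the barycentre have weighted sum 2Wr − 2Wr = 0.
sphere-strictly-convex :
  (w : Fin n → ℕ) (v : Fin n → Fin m → ℕ) (c : Fin m → ℕ) →
  (∀ i → w i * dot (v i) (v i) ≡ w i * r) → dot c c ≡ r →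
  (∀ e → sum (λ i → w i * v i e) ≡ sum w * c e) →
  ∀ i → w i * dist² (v i) c ≡ 0
sphere-strictly-convex {n} {r = r} w v c vv cc bary i =
  n≤0⇒n≡0 (subst (_ ≤_) ∑≡0 (term≤sum (λ i → w i * dist² (v i) c) i))
  where
  open ≡-Reasoning
  W : ℕ
  W = sum w

  ∑wdot : sum (λ i → w i * dot (v i) c) ≡ W * r
  ∑wdot = begin
    sum (λ i → w i * dot (v i) c)          ≡⟨ weighted-dot w v c ⟩
    dot (λ e → sum λ i → w i * v i e) c    ≡⟨ sum-cong-≗ (λ e → cong (_* c e) (bary e)) ⟩
    sum (λ e → W * c e * c e)              ≡⟨ sum-cong-≗ (λ e → *-assoc W (c e) (c e)) ⟩
    sum (λ e → W * (c e * c e))            ≡⟨ *-distribˡ-sum W (λ e → c e * c e) ⟨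
    W * dot c c                            ≡⟨ cong (W *_) cc ⟩
    W * r                                  ∎

  pointwise : ∀ i → w i * dist² (v i) c + 2 * (w i * dot (v i) c) ≡ w i * (2 * r)
  pointwise i = begin
    w i * dist² (v i) c + 2 * (w i * dot (v i) c)
      ≡⟨ solve 3 (λ w d p → w :* d :+ con 2 :* (w :* p) := w :* (d :+ con 2 :* p)) refl
           (w i) (dist² (v i) c) (dot (v i) c) ⟩
    w i * (dist² (v i) c + 2 * dot (v i) c)
      ≡⟨ cong (w i *_) (dist²-expand (v i) c) ⟩
    w i * (dot (v i) (v i) + dot c c)
      ≡⟨ *-distribˡ-+ (w i) _ _ ⟩
    w i * dot (v i) (v i) + w i * dot c c
      ≡⟨ cong₂ _+_ (vv i) (cong (w i *_) cc) ⟩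
    w i * r + w i * r
      ≡⟨ solve 2 (λ w r → w :* r :+ w :* r := w :* (con 2 :* r)) refl (w i) r ⟩
    w i * (2 * r) ∎
    where open +-*-Solver

  ∑≡0 : sum (λ i → w i * dist² (v i) c) ≡ 0
  ∑≡0 = +-cancelʳ-≡ (2 * (W * r)) _ 0 (begin
    sum (λ i → w i * dist² (v i) c) + 2 * (W * r)
      ≡⟨ cong (λ z → sum (λ i → w i * dist² (v i) c) + 2 * z) ∑wdot ⟨
    sum (λ i → w i * dist² (v i) c) + 2 * sum (λ i → w i * dot (v i) c)
      ≡⟨ cong (sum (λ i → w i * dist² (v i) c) +_) (*-distribˡ-sum 2 (λ i → w i * dot (v i) c)) ⟩
    sum (λ i → w i * dist² (v i) c) + sum (λ i → 2 * (w i * dot (v i) c))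
      ≡⟨ ∑-distrib-+ (λ i → w i * dist² (v i) c) (λ i → 2 * (w i * dot (v i) c)) ⟨
    sum (λ i → w i * dist² (v i) c + 2 * (w i * dot (v i) c))
      ≡⟨ sum-cong-≗ pointwise ⟩
    sum (λ i → w i * (2 * r))
      ≡⟨ *-distribʳ-sum (2 * r) w ⟨
    W * (2 * r)
      ≡⟨ solve 2 (λ w r → w :* (con 2 :* r) := con 2 :* (w :* r)) refl W r ⟩
    2 * (W * r) ∎)
    where open +-*-Solver

-- Subsets of `Fin n` as 0/1 weights, and removal of a point.

𝟙 : Subset n → Fin n → ℕ
𝟙 S i = if lookup S i then 1 else 0

∈⇒𝟙≡1 : ∀ {S : Subset n} {i} → i ∈ S → 𝟙 S i ≡ 1
∈⇒𝟙≡1 i∈S rewrite []=⇒lookup i∈S = refl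

∈∨𝟙≡0 : ∀ (S : Subset n) i → i ∈ S ⊎ 𝟙 S i ≡ 0
∈∨𝟙≡0 S i with lookup S i in eq
... | true  = inj₁ (lookup⇒[]= i S eq)
... | false = inj₂ refl

-- Off `S` the weight is 0 and both sides vanish, so the comparison is asked for only at members of
-- `S`.
𝟙-mono : ∀ (S : Subset n) i {a b} → (i ∈ S → a ≤ b) → 𝟙 S i * a ≤ 𝟙 S i * b
𝟙-mono S i a≤b with ∈∨𝟙≡0 S i
... | inj₁ i∈S = *-monoʳ-≤ (𝟙 S i) (a≤b i∈S)
... | inj₂ eq rewrite eq = z≤n

𝟙-cong : ∀ (S : Subset n) i {a b} → (i ∈ S → a ≡ b) → 𝟙 S i * a ≡ 𝟙 S i * b
𝟙-cong S i a≡b = ≤-antisym (𝟙-mono S i (≤-reflexive ∘ a≡b)) (𝟙-mono S i (≤-reflexive ∘ sym ∘ a≡b))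

∑𝟙≡∣∣ : (S : Subset n) → sum (𝟙 S) ≡ ∣ S ∣
∑𝟙≡∣∣ {zero} [] = refl
∑𝟙≡∣∣ (true  ∷ S) = cong suc (∑𝟙≡∣∣ S)
∑𝟙≡∣∣ (false ∷ S) = ∑𝟙≡∣∣ S

∣∣-remove : ∀ {S : Subset n} {j} → j ∈ S → ∣ S ∣ ≡ suc ∣ S [ j ]≔ outside ∣
∣∣-remove here = refl
∣∣-remove {S = true  ∷ S} (there j∈S) = cong suc (∣∣-remove j∈S)
∣∣-remove {S = false ∷ S} (there j∈S) = ∣∣-remove j∈S

-- Applied to `toℕ`, this separates the barycentre `j` from the other points of a barycentric set.
∑𝟙-remove : ∀ {S : Subset n} {j} (g : Fin n → ℕ) → j ∈ S →
            sum (λ i → 𝟙 S i * g i) ≡ g j + sum (λ i → 𝟙 (S [ j ]≔ outside) i * g i)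
∑𝟙-remove {S = true ∷ S} g here =
  cong (_+ sum (λ i → 𝟙 S i * g (suc i))) (*-identityˡ (g zero))
∑𝟙-remove {S = s ∷ S} {suc j} g (there j∈S) = begin
  x + sum (λ i → 𝟙 S i * g (suc i))  ≡⟨ cong (x +_) (∑𝟙-remove (g ∘ suc) j∈S) ⟩
  x + (g (suc j) + y)                ≡⟨ solve 3 (λ x g y → x :+ (g :+ y) := g :+ (x :+ y)) refl x (g (suc j)) y ⟩
  g (suc j) + (x + y)                ∎
  where
  open ≡-Reasoning
  open +-*-Solver
  x = 𝟙 (s ∷ S) zero * g zero
  y = sum (λ i → 𝟙 (S [ j ]≔ outside) i * g (suc i))

∉-remove : (S : Subset n) (j : Fin n) → j ∉ S [ j ]≔ outside
∉-remove (s ∷ S) zero    ()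
∉-remove (s ∷ S) (suc j) (there j∈) = ∉-remove S j j∈

remove-⊆ : (S : Subset n) (j : Fin n) → S [ j ]≔ outside ⊆ S
remove-⊆ (s ∷ S) zero    (there i∈) = there i∈
remove-⊆ (s ∷ S) (suc j) here       = here
remove-⊆ (s ∷ S) (suc j) (there i∈) = there (remove-⊆ S j i∈)

nonempty : (S : Subset n) → 0 < ∣ S ∣ → ∃ λ i → i ∈ S
nonempty (true  ∷ S) _ = zero , here
nonempty (false ∷ S) 0<∣S∣ with nonempty S 0<∣S∣
... | i , i∈S = suc i , there i∈S

-- Ranks within a subset and pigeonhole counting.

rank : Subset n → Fin n → ℕ
rank (s ∷ S) zero    = 0
rank (s ∷ S) (suc i) = (if s then 1 else 0) + rank S i

rank<∣∣ : ∀ {S : Subset n} {i} → i ∈ S → rank S i < ∣ S ∣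
rank<∣∣ here = s≤s z≤n
rank<∣∣ {S = true  ∷ S} (there i∈S) = s≤s (rank<∣∣ i∈S)
rank<∣∣ {S = false ∷ S} (there i∈S) = rank<∣∣ i∈S

-- `rank S i` counts the members of `S` before `i`. Together with `rank<∣∣` this numbers the members
-- of `S` by the naturals below ∣S∣.
rank-injective : ∀ {S : Subset n} {i j} → i ∈ S → j ∈ S → rank S i ≡ rank S j → i ≡ j
rank-injective here here _ = refl
rank-injective {S = true  ∷ S} (there i∈S) (there j∈S) eq = cong suc (rank-injective i∈S j∈S (suc-injective eq))
rank-injective {S = false ∷ S} (there i∈S) (there j∈S) eq = cong suc (rank-injective i∈S j∈S eq)

-- The pair of the class `ν t` and the rank of `f t` inside `A (ν t)` determines `t`, and there are
-- at most K · L such pairs. All classes are counted at once, so no largest class has to be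
-- selected.
pigeonhole-subsets : ∀ {N K L} (A : ℕ → Subset n) (ν : Fin N → ℕ) (f : Fin N → Fin n) →
  (∀ {s t} → f s ≡ f t → s ≡ t) → (∀ t → ν t < K) → (∀ t → f t ∈ A (ν t)) →
  (∀ r → ∣ A r ∣ ≤ L) → N ≤ K * L
pigeonhole-subsets {N = N} {K} {L} A ν f f-injective ν<K f∈A ∣A∣≤L = Fin.injective⇒≤ {f = g} g-injective
  where
  rank< : ∀ t → rank (A (ν t)) (f t) < L
  rank< t = <-≤-trans (rank<∣∣ (f∈A t)) (∣A∣≤L (ν t))

  g : Fin N → Fin (K * L)
  g t = combine (fromℕ< (ν<K t)) (fromℕ< (rank< t))

  fromℕ<-inj : ∀ {a b c} (p : a < c) (q : b < c) → fromℕ< p ≡ fromℕ< q → a ≡ b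
  fromℕ<-inj p q eq = trans (sym (Fin.toℕ-fromℕ< p)) (trans (cong toℕ eq) (Fin.toℕ-fromℕ< q))

  g-injective : ∀ {s t} → g s ≡ g t → s ≡ t
  g-injective {s} {t} eq with Fin.combine-injective _ _ _ _ eq
  -- The classes are identified first: only then are both ranks taken in the same subset.
  ... | νeq , rankeq = f-injective (rank-injective {S = A (ν t)}
    (subst (λ z → f s ∈ A z) νs≡νt (f∈A s)) (f∈A t)
    (trans (cong (λ z → rank (A z) (f s)) (sym νs≡νt)) (fromℕ<-inj (rank< s) (rank< t) rankeq)))
    where
    νs≡νt : ν s ≡ ν t
    νs≡νt = fromℕ<-inj (ν<K s) (ν<K t) νeq

-- Sums in ℤ/nℤ computed on representatives.

module _ (n : ℕ) .{{_ : NonZero n}} where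
  open AbelianGroup (ℤ/-abelianGroup n) using (rawMonoid; commutativeMonoid)
  open RawMonoidDefs rawMonoid using () renaming (_×_ to _·_)
  open CommutativeMonoidSum commutativeMonoid using () renaming (sum to sumMod)

  toℕ-mod : ∀ a → toℕ (a mod n) ≡ a % n
  toℕ-mod a = Fin.toℕ-fromℕ< (m%n<n a n)

  -- The natural number `b` is left unreduced. This is the common induction step for sums and
  -- multiples, whose reductions are thereby collected into a single one at the end.
  toℕ-addMod-% : ∀ i {j} b → toℕ j ≡ b % n → toℕ (addMod n i j) ≡ (toℕ i + b) % n
  toℕ-addMod-% i {j} b eq = begin
    toℕ (addMod n i j)                ≡⟨ toℕ-mod (toℕ i + toℕ j) ⟩
    (toℕ i + toℕ j) % n               ≡⟨ cong (λ z → (toℕ i + z) % n) eq ⟩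
    (toℕ i + b % n) % n               ≡⟨ %-distribˡ-+ (toℕ i) (b % n) n ⟩
    (toℕ i % n + b % n % n) % n       ≡⟨ cong (λ z → (toℕ i % n + z) % n) (m%n%n≡m%n b n) ⟩
    (toℕ i % n + b % n) % n           ≡⟨ %-distribˡ-+ (toℕ i) b n ⟨
    (toℕ i + b) % n                   ∎
    where open ≡-Reasoning

  toℕ-sumMod : ∀ {p} (f : Fin p → Fin n) → toℕ (sumMod f) ≡ sum (toℕ ∘ f) % n
  toℕ-sumMod {zero}  f = toℕ-mod 0
  toℕ-sumMod {suc p} f = toℕ-addMod-% (f zero) (sum (toℕ ∘ f ∘ suc)) (toℕ-sumMod (f ∘ suc))

  toℕ-·Mod : ∀ k j → toℕ (k · j) ≡ (k * toℕ j) % n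
  toℕ-·Mod zero    j = toℕ-mod 0
  toℕ-·Mod (suc k) j = toℕ-addMod-% j (k * toℕ j) (toℕ-·Mod k j)

  toℕ-∑ : ∀ S → toℕ (∑ (ℤ/ n ℤ) S) ≡ sum (λ i → 𝟙 S i * toℕ i) % n
  toℕ-∑ S = trans (toℕ-sumMod (λ i → if lookup S i then i else zeroMod n))
                  (cong (_% n) (sum-cong-≗ pointwise))
    where
    pointwise : ∀ i → toℕ (if lookup S i then i else zeroMod n) ≡ 𝟙 S i * toℕ i
    pointwise i with lookup S i
    ... | true  = sym (*-identityˡ (toℕ i))
    ... | false = trans (toℕ-mod 0) (m<n⇒m%n≡m (>-nonZero⁻¹ n))

  barycentric⇒% : ∀ {k S} → ((j , _) : ∃ λ j → j ∈ S × ∑ (ℤ/ n ℤ) S ≡ k · j) →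
                  sum (λ i → 𝟙 S i * toℕ i) % n ≡ (k * toℕ j) % n
  barycentric⇒% {k} {S} (j , _ , eq) = trans (sym (toℕ-∑ S)) (trans (cong toℕ eq) (toℕ-·Mod k j))

-- Base-`b` expansions, least significant digit first.

module Base (b : ℕ) .{{_ : NonZero b}} where

  value : (Fin m → ℕ) → ℕ
  value {zero}  c = 0
  value {suc m} c = c zero + value (c ∘ suc) * b

  digit : ℕ → Fin m → ℕ
  digit x zero    = x % b
  digit x (suc e) = digit (x / b) e

  value-cong : {c d : Fin m → ℕ} → (∀ e → c e ≡ d e) → value c ≡ value d
  value-cong {zero}  c≗d = refl
  value-cong {suc m} c≗d = cong₂ (λ x y → x + y * b) (c≗d zero) (value-cong (c≗d ∘ suc))

  -- The first m digits determine a number only modulo b^m, hence the bound on `x`; dividing by `b`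
  -- lowers the exponent by one.
  value-digit : ∀ m x → x < b ^ m → value {m} (digit x) ≡ x
  value-digit zero    zero    _ = refl
  value-digit zero    (suc x) (s≤s ())
  value-digit (suc m) x x<b^m = trans
    (cong (λ z → x % b + z * b) (value-digit m (x / b) (m<n*o⇒m/o<n (subst (x <_) (*-comm b (b ^ m)) x<b^m))))
    (sym (m≡m%n+[m/n]*n x b))

  -- With entries below `b`, the remainder modulo `b` is the first entry and the quotient is the
  -- value of the tail.
  digit-value : (c : Fin m → ℕ) → (∀ e → c e < b) → ∀ e → digit (value c) e ≡ c e
  digit-value {suc m} c c<b zero =
    trans ([m+kn]%n≡m%n (c zero) (value (c ∘ suc)) b) (m<n⇒m%n≡m (c<b zero))
  digit-value {suc m} c c<b (suc e) = trans
    (cong (λ z → digit z e) (begin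
      (c zero + v * b) / b      ≡⟨ +-distrib-/-∣ʳ (c zero) (divides-refl v) ⟩
      c zero / b + v * b / b    ≡⟨ cong₂ _+_ (m<n⇒m/n≡0 (c<b zero)) (m*n/n≡m v b) ⟩
      v                         ∎))
    (digit-value (c ∘ suc) (c<b ∘ suc) e)
    where
    open ≡-Reasoning
    v = value (c ∘ suc)

  value-injective : (c d : Fin m → ℕ) → (∀ e → c e < b) → (∀ e → d e < b) →
                    value c ≡ value d → ∀ e → c e ≡ d e
  value-injective c d c<b d<b eq e = begin
    c e                 ≡⟨ digit-value c c<b e ⟨
    digit (value c) e   ≡⟨ cong (λ z → digit z e) eq ⟩
    digit (value d) e   ≡⟨ digit-value d d<b e ⟩
    d e                 ∎
    where open ≡-Reasoning

  value<b^ : (c : Fin m → ℕ) → (∀ e → c e < b) → value c < b ^ m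
  value<b^ {zero}  c c<b = s≤s z≤n
  value<b^ {suc m} c c<b = begin-strict
    c zero + v * b  <⟨ +-monoˡ-< (v * b) (c<b zero) ⟩
    suc v * b       ≤⟨ *-monoˡ-≤ b (value<b^ (c ∘ suc) (c<b ∘ suc)) ⟩
    b ^ m * b       ≡⟨ *-comm (b ^ m) b ⟩
    b * b ^ m       ∎
    where
    open ≤-Reasoning
    v = value (c ∘ suc)

  value-scale : ∀ k (c : Fin m → ℕ) → value (λ e → k * c e) ≡ k * value c
  value-scale {zero}  k c = sym (*-zeroʳ k)
  value-scale {suc m} k c = trans
    (cong (λ z → k * c zero + z * b) (value-scale k (c ∘ suc)))
    (solve 4 (λ k c v b → k :* c :+ k :* v :* b := k :* (c :+ v :* b)) refl k (c zero) (value (c ∘ suc)) b)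
    where open +-*-Solver

  -- `value` evaluates a polynomial at `b`, so it is linear in arbitrary coefficients. That these
  -- are below `b` matters only when coefficients are read back by `value-injective`.
  value-sum : (w : Fin n → ℕ) (v : Fin n → Fin m → ℕ) →
              sum (λ i → w i * value (v i)) ≡ value (λ e → sum λ i → w i * v i e)
  value-sum {n} {zero} w v = begin
    sum (λ i → w i * 0)     ≡⟨ sum-cong-≗ (λ i → *-zeroʳ (w i)) ⟩
    sum {n} (λ _ → 0)       ≡⟨ sum-const n 0 ⟩
    n * 0                   ≡⟨ *-zeroʳ n ⟩
    0                       ∎
    where open ≡-Reasoning
  value-sum {m = suc m} w v = begin
    sum (λ i → w i * (v i zero + x i * b))
      ≡⟨ sum-cong-≗ (λ i → solve 4 (λ w c x b → w :* (c :+ x :* b) := w :* c :+ w :* x :* b) refl (w i) (v i zero) (x i) b) ⟩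
    sum (λ i → w i * v i zero + w i * x i * b)
      ≡⟨ ∑-distrib-+ (λ i → w i * v i zero) (λ i → w i * x i * b) ⟩
    sum (λ i → w i * v i zero) + sum (λ i → w i * x i * b)
      ≡⟨ cong (sum (λ i → w i * v i zero) +_) (*-distribʳ-sum b (λ i → w i * x i)) ⟨
    sum (λ i → w i * v i zero) + sum (λ i → w i * x i) * b
      ≡⟨ cong (λ z → sum (λ i → w i * v i zero) + z * b) (value-sum w (λ i → v i ∘ suc)) ⟩
    sum (λ i → w i * v i zero) + value (λ e → sum λ i → w i * v i (suc e)) * b ∎
    where
    open ≡-Reasoning
    open +-*-Solver
    x = λ i → value (v i ∘ suc)

-- Spheres of digit vectors in ℤ/nℤ.

module _ (n b : ℕ) .{{_ : NonZero n}} .{{_ : NonZero b}} where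
  open Base b

  -- The bound by b^m makes the m digits determine `i`, so these residues correspond to lattice
  -- points of squared norm `r`.
  record OnSphere (m h r : ℕ) (i : Fin n) : Set where
    constructor onSphere
    field
      i<b^m   : toℕ i < b ^ m
      digit≤h : ∀ e → digit {m} (toℕ i) e ≤ h
      norm≡r  : dot (digit {m} (toℕ i)) (digit (toℕ i)) ≡ r

  open OnSphere

  onSphere? : ∀ m h r i → Dec (OnSphere m h r i)
  onSphere? m h r i = map′ (λ (p , q , s) → onSphere p q s) (λ (onSphere p q s) → p , q , s)
    (toℕ i <? b ^ m ×-dec Fin.all? (λ e → digit {m} (toℕ i) e ≤? h)
      ×-dec dot (digit {m} (toℕ i)) (digit (toℕ i)) ≟ r)

  sphere : ℕ → ℕ → ℕ → Subset n
  sphere m h r = tabulate λ i → does (onSphere? m h r i)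

  OnSphere⇒∈ : ∀ {m h r i} → OnSphere m h r i → i ∈ sphere m h r
  OnSphere⇒∈ {m} {h} {r} {i} p = lookup⇒[]= i _
    (trans (lookup∘tabulate _ i) (dec-true (onSphere? m h r i) p))

  ∈⇒OnSphere : ∀ {m h r i} → i ∈ sphere m h r → OnSphere m h r i
  ∈⇒OnSphere {m} {h} {r} {i} i∈ =
    does-true (onSphere? m h r i) (trans (sym (lookup∘tabulate _ i)) ([]=⇒lookup i∈))
    where
    does-true : ∀ {p} {P : Set p} (P? : Dec P) → does P? ≡ true → P
    does-true (yes p) _ = p

  -- Each of the k summands is at most b^m - 1. Hence the sum of representatives is already reduced
  -- modulo n.
  sphere-∑<n : ∀ {m h r k S} .{{_ : NonZero k}} → k * b ^ m ≤ n → S ⊆ sphere m h r → ∣ S ∣ ≡ k →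
        sum (λ i → 𝟙 S i * toℕ i) < n
  sphere-∑<n {m} {h} {r} {k} {S} kb^m≤n S⊆ ∣S∣≡k = begin-strict
    -- Adding k = ∣S∣ raises each summand by one; strictness comes from k being nonzero.
    x                                    <⟨ m<m+n x (>-nonZero⁻¹ k) ⟩
    x + k                                ≡⟨ cong (x +_) (trans (∑𝟙≡∣∣ S) ∣S∣≡k) ⟨
    x + sum (𝟙 S)                        ≡⟨ ∑-distrib-+ (λ i → 𝟙 S i * toℕ i) (𝟙 S) ⟨
    sum (λ i → 𝟙 S i * toℕ i + 𝟙 S i)    ≡⟨ sum-cong-≗ (λ i → trans (+-comm (𝟙 S i * toℕ i) (𝟙 S i)) (sym (*-suc (𝟙 S i) (toℕ i)))) ⟩
    sum (λ i → 𝟙 S i * suc (toℕ i))      ≤⟨ sum-mono (λ i → 𝟙-mono S i λ i∈S → i<b^m (∈⇒OnSphere {m} {h} {r} (S⊆ i∈S))) ⟩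
    sum (λ i → 𝟙 S i * b ^ m)            ≡⟨ *-distribʳ-sum (b ^ m) (𝟙 S) ⟨
    sum (𝟙 S) * b ^ m                    ≡⟨ cong (_* b ^ m) (trans (∑𝟙≡∣∣ S) ∣S∣≡k) ⟩
    k * b ^ m                            ≤⟨ kb^m≤n ⟩
    n                                    ∎
    where
    open ≤-Reasoning
    x = sum (λ i → 𝟙 S i * toℕ i)

  -- Deleting g_j turns the barycentric equation into Σ_{i ≠ j} g_i = (k − 1) g_j,
  -- whose two sides have base-b digits at most (k − 1)h < b: no carries occur.
  sphere-¬barycentric : ∀ {m h r k S} → 1 ≤ k → k * h < b → suc k * b ^ m ≤ n →
    S ⊆ sphere m h r → ¬ Barycentric (ℤ/ n ℤ) (suc k) S
  sphere-¬barycentric {m} {h} {r} {k} {S} 1≤k kh<b kb^m≤n S⊆ (∣S∣≡ , j , j∈S , eq)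
    -- Here `S` has k + 1 elements, so removing `j` leaves k ≥ 1 of them; the element `i` chosen
    -- among these will turn out to equal `j`.
    with nonempty (S [ j ]≔ outside) (subst (1 ≤_) (suc-injective (trans (sym ∣S∣≡) (∣∣-remove j∈S))) 1≤k)
  ... | i , i∈T = ∉-remove S j (subst (_∈ T) i≡j i∈T)
    where
    T : Subset n
    T = S [ j ]≔ outside

    d : Fin n → Fin m → ℕ
    d i = digit (toℕ i)

    on : ∀ {i} → i ∈ S → OnSphere m h r i
    on i∈S = ∈⇒OnSphere {m} {h} {r} (S⊆ i∈S)

    onT : ∀ {i} → i ∈ T → OnSphere m h r i
    onT i∈T = on (remove-⊆ S j i∈T)

    ∑T≡k : sum (𝟙 T) ≡ k
    ∑T≡k = trans (∑𝟙≡∣∣ T) (suc-injective (trans (sym (∣∣-remove j∈S)) ∣S∣≡))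

    kj<n : suc k * toℕ j < n
    kj<n = <-≤-trans (*-monoʳ-< (suc k) (i<b^m (on j∈S))) kb^m≤n

    -- Both sides are below n, so the congruence modulo n is an equality of naturals.
    ∑S≡ : sum (λ i → 𝟙 S i * toℕ i) ≡ suc k * toℕ j
    ∑S≡ = begin
      sum (λ i → 𝟙 S i * toℕ i)      ≡⟨ m<n⇒m%n≡m (sphere-∑<n {m} {h} {r} kb^m≤n S⊆ ∣S∣≡) ⟨
      sum (λ i → 𝟙 S i * toℕ i) % n  ≡⟨ barycentric⇒% n {suc k} {S} (j , j∈S , eq) ⟩
      (suc k * toℕ j) % n            ≡⟨ m<n⇒m%n≡m kj<n ⟩
      suc k * toℕ j                  ∎
      where open ≡-Reasoning

    ∑T≡ : sum (λ i → 𝟙 T i * toℕ i) ≡ k * toℕ j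
    ∑T≡ = +-cancelˡ-≡ (toℕ j) _ _ (trans (sym (∑𝟙-remove toℕ j∈S)) ∑S≡)

    value-d : ∀ {i} → i ∈ S → value (d i) ≡ toℕ i
    value-d {i} i∈S = value-digit m (toℕ i) (i<b^m (on i∈S))

    value≡ : value (λ e → sum λ i → 𝟙 T i * d i e) ≡ value (λ e → k * d j e)
    value≡ = begin
      value (λ e → sum λ i → 𝟙 T i * d i e)  ≡⟨ value-sum (𝟙 T) d ⟨
      sum (λ i → 𝟙 T i * value (d i))        ≡⟨ sum-cong-≗ (λ i → 𝟙-cong T i λ i∈T → value-d (remove-⊆ S j i∈T)) ⟩
      sum (λ i → 𝟙 T i * toℕ i)              ≡⟨ ∑T≡ ⟩
      k * toℕ j                              ≡⟨ cong (k *_) (value-d j∈S) ⟨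
      k * value (d j)                        ≡⟨ value-scale k (d j) ⟨
      value (λ e → k * d j e)                ∎
      where open ≡-Reasoning

    ∑digit<b : ∀ e → sum (λ i → 𝟙 T i * d i e) < b
    ∑digit<b e = begin-strict
      sum (λ i → 𝟙 T i * d i e)  ≤⟨ sum-mono (λ i → 𝟙-mono T i λ i∈T → digit≤h (onT i∈T) e) ⟩
      sum (λ i → 𝟙 T i * h)      ≡⟨ *-distribʳ-sum h (𝟙 T) ⟨
      sum (𝟙 T) * h              ≡⟨ cong (_* h) ∑T≡k ⟩
      k * h                      <⟨ kh<b ⟩
      b                          ∎
      where open ≤-Reasoning

    digits≡ : ∀ e → sum (λ i → 𝟙 T i * d i e) ≡ sum (𝟙 T) * d j e
    digits≡ e = trans
      (value-injective _ _ ∑digit<b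
        (λ e → ≤-<-trans (*-monoʳ-≤ k (digit≤h (on j∈S) e)) kh<b) value≡ e)
      (cong (_* d j e) (sym ∑T≡k))

    dist≡0 : dist² (d i) (d j) ≡ 0
    dist≡0 = begin
      -- The weight of `i` is 1, so the weighted distance that strict convexity annihilates is the
      -- distance itself.
      dist² (d i) (d j)            ≡⟨ *-identityˡ _ ⟨
      1 * dist² (d i) (d j)        ≡⟨ cong (_* dist² (d i) (d j)) (∈⇒𝟙≡1 i∈T) ⟨
      𝟙 T i * dist² (d i) (d j)    ≡⟨ sphere-strictly-convex (𝟙 T) d (d j)
                                        (λ i → 𝟙-cong T i λ i∈T → norm≡r (onT i∈T))
                                        (norm≡r (on j∈S)) digits≡ i ⟩
      0                            ∎
      where open ≡-Reasoning

    i≡j : i ≡ j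
    i≡j = Fin.toℕ-injective (begin
      toℕ i        ≡⟨ value-d (remove-⊆ S j i∈T) ⟨
      value (d i)  ≡⟨ value-cong (dist²≡0⇒≗ (d i) (d j) dist≡0) ⟩
      value (d j)  ≡⟨ value-d j∈S ⟩
      toℕ j        ∎)
      where open ≡-Reasoning

  ∣sphere∣≤BO : ∀ {m h k} → 1 ≤ k → k * h < b → suc k * b ^ m ≤ n →
                ∀ r → ∣ sphere m h r ∣ ≤ BO (suc k) (ℤ/ n ℤ)
  ∣sphere∣≤BO {m} {h} {k} 1≤k kh<b kb^m≤n r = ≮⇒≥ λ BO<∣A∣ →
    let S , S⊆A , bary = BO-property (suc k) (ℤ/ n ℤ) (sphere m h r) (<⇒≤ BO<∣A∣)
    in sphere-¬barycentric {m} {h} {r} {k} 1≤k kh<b kb^m≤n S⊆A bary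

  -- `finToFun` lists all (h + 1)^m digit vectors, `value` places them injectively in ℤ/nℤ, and
  -- their squared norms sort them into spheres, each of size at most BO.
  D^m≤mD²BO : ∀ {m h k} .{{_ : NonZero m}} → 1 ≤ k → k * h < b → suc k * b ^ m ≤ n →
              suc h ^ m ≤ (m * (suc h * suc h)) * BO (suc k) (ℤ/ n ℤ)
  D^m≤mD²BO {m} {h} {k} 1≤k kh<b kb^m≤n =
    pigeonhole-subsets (sphere m h) (λ t → dot (c t) (c t)) f f-injective ν<
      (λ t → OnSphere⇒∈ {m} {h} (on t)) (∣sphere∣≤BO {m} {h} 1≤k kh<b kb^m≤n)
    where
    N = suc h ^ m

    c : Fin N → Fin m → ℕ
    c t e = toℕ (finToFun t e)

    c≤h : ∀ t e → c t e ≤ h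
    c≤h t e = s≤s⁻¹ (Fin.toℕ<n (finToFun t e))

    c<b : ∀ t e → c t e < b
    -- Since k ≥ 1, the bound on sums of k digits also bounds a single digit: h ≤ kh < b.
    c<b t e = ≤-<-trans (≤-trans (c≤h t e) (m≤n*m h k {{>-nonZero 1≤k}})) kh<b

    value<n : ∀ t → value (c t) < n
    value<n t = <-≤-trans (value<b^ (c t) (c<b t)) (≤-trans (m≤n*m (b ^ m) (suc k)) kb^m≤n)

    f : Fin N → Fin n
    f t = fromℕ< (value<n t)

    toℕ-f : ∀ t → toℕ (f t) ≡ value (c t)
    toℕ-f t = Fin.toℕ-fromℕ< (value<n t)

    digit-f : ∀ t e → digit (toℕ (f t)) e ≡ c t e
    digit-f t e = trans (cong (λ z → digit z e) (toℕ-f t)) (digit-value (c t) (c<b t) e)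

    on : ∀ t → OnSphere m h (dot (c t) (c t)) (f t)
    on t = onSphere
      (subst (_< b ^ m) (sym (toℕ-f t)) (value<b^ (c t) (c<b t)))
      (λ e → subst (_≤ h) (sym (digit-f t e)) (c≤h t e))
      (sum-cong-≗ λ e → cong₂ _*_ (digit-f t e) (digit-f t e))

    f-injective : ∀ {s t} → f s ≡ f t → s ≡ t
    f-injective {s} {t} eq = begin
      s                               ≡⟨ Fin.funToFin-finToFin {m} {suc h} s ⟨
      funToFin (finToFun {suc h} {m} s)   ≡⟨ funToFin-cong (λ e → Fin.toℕ-injective
                                           (trans (sym (digit-f s e)) (trans (cong (λ z → digit (toℕ z) e) eq) (digit-f t e)))) ⟩
      funToFin (finToFun {suc h} {m} t)   ≡⟨ Fin.funToFin-finToFin {m} {suc h} t ⟩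
      t                               ∎
      where
      open ≡-Reasoning
      funToFin-cong : ∀ {p q} {g g′ : Fin p → Fin q} → (∀ e → g e ≡ g′ e) → funToFin g ≡ funToFin g′
      funToFin-cong {zero}  _   = refl
      funToFin-cong {suc p} g≗g′ = cong₂ combine (g≗g′ zero) (funToFin-cong (g≗g′ ∘ suc))

    ν< : ∀ t → dot (c t) (c t) < m * (suc h * suc h)
    ν< t = begin-strict
      dot (c t) (c t)          ≤⟨ sum-mono (λ e → *-mono-≤ (c≤h t e) (c≤h t e)) ⟩
      sum {m} (λ _ → h * h)    ≡⟨ sum-const m (h * h) ⟩
      -- Strict because `m` is nonzero; this puts the norm among the m(h + 1)² classes.
      m * (h * h)              <⟨ *-monoʳ-< m (*-mono-< (n<1+n h) (n<1+n h)) ⟩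
      m * (suc h * suc h)      ∎
      where open ≤-Reasoning

-- Writing the dimension as 2 + l exposes the factor (h + 1)² on both sides, which is then
-- cancelled.
D^l≤mBO : ∀ n b l h k .{{_ : NonZero n}} .{{_ : NonZero b}} → 1 ≤ k → k * h < b → suc k * b ^ (2 + l) ≤ n →
          suc h ^ l ≤ (2 + l) * BO (suc k) (ℤ/ n ℤ)
D^l≤mBO n b l h k 1≤k kh<b kb^m≤n = *-cancelˡ-≤ (suc h * suc h) (begin
  suc h * suc h * suc h ^ l                    ≡⟨ *-assoc (suc h) (suc h) (suc h ^ l) ⟩
  suc h ^ (2 + l)                              ≤⟨ D^m≤mD²BO n b {2 + l} {h} {k} 1≤k kh<b kb^m≤n ⟩
  (2 + l) * (suc h * suc h) * L                ≡⟨ solve 3 (λ m d x → m :* d :* x := d :* (m :* x)) refl (2 + l) (suc h * suc h) L ⟩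
  suc h * suc h * ((2 + l) * L)                ∎)
  where
  open ≤-Reasoning
  open +-*-Solver
  L = BO (suc k) (ℤ/ n ℤ)

-- Rational bounds on the root

open import Data.Integer.Base as ℤ using (+_)

/-mono-cross-≤ : ∀ {a b c d} .{{_ : NonZero b}} .{{_ : NonZero d}} →
                 a * d ≤ c * b → + a ℚ./ b ℚ.≤ + c ℚ./ d
/-mono-cross-≤ {a} {suc b} {c} {suc d} ad≤cb = ℚ.toℚᵘ-cancel-≤ (begin
  toℚᵘ (+ a ℚ./ suc b)  ≃⟨ ℚ.toℚᵘ-fromℚᵘ (ℚᵘ.mkℚᵘ (+ a) b) ⟩
  ℚᵘ.mkℚᵘ (+ a) b       ≤⟨ ℚᵘ.*≤* (subst₂ ℤ._≤_ (ℤ.pos-* a (suc d)) (ℤ.pos-* c (suc b)) (ℤ.+≤+ ad≤cb)) ⟩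
  ℚᵘ.mkℚᵘ (+ c) d       ≃⟨ ℚ.toℚᵘ-fromℚᵘ (ℚᵘ.mkℚᵘ (+ c) d) ⟨
  toℚᵘ (+ c ℚ./ suc d)  ∎)
  where open ℚᵘ.≤-Reasoning

/-mono-cross-< : ∀ {a b c d} .{{_ : NonZero b}} .{{_ : NonZero d}} →
                 a * d < c * b → + a ℚ./ b ℚ.< + c ℚ./ d
/-mono-cross-< {a} {suc b} {c} {suc d} ad<cb = ℚ.toℚᵘ-cancel-< (begin-strict
  toℚᵘ (+ a ℚ./ suc b)  ≃⟨ ℚ.toℚᵘ-fromℚᵘ (ℚᵘ.mkℚᵘ (+ a) b) ⟩
  ℚᵘ.mkℚᵘ (+ a) b       <⟨ ℚᵘ.*<* (subst₂ ℤ._<_ (ℤ.pos-* a (suc d)) (ℤ.pos-* c (suc b)) (ℤ.+<+ ad<cb)) ⟩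
  ℚᵘ.mkℚᵘ (+ c) d       ≃⟨ ℚ.toℚᵘ-fromℚᵘ (ℚᵘ.mkℚᵘ (+ c) d) ⟨
  toℚᵘ (+ c ℚ./ suc d)  ∎)
  where open ℚᵘ.≤-Reasoning

-- The constant term of the Cauchy sequence `fromℕ a`.
ι : ℕ → ℚ
ι a = + a ℚ./ 1

ι-mono-≤ : ∀ {a b} → a ≤ b → ι a ℚ.≤ ι b
ι-mono-≤ {a} {b} a≤b = /-mono-cross-≤ {a} {1} {b} {1} (*-monoˡ-≤ 1 a≤b)

0≤ι : ∀ a → 0ℚ ℚ.≤ ι a
0≤ι a = ι-mono-≤ {0} {a} z≤n

ι-homo-+ : ∀ a b → ι (a + b) ≡ ι a ℚ.+ ι b
ι-homo-+ a b = ℚ.toℚᵘ-injective (begin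
  toℚᵘ (ι (a + b))                     ≈⟨ ℚ.toℚᵘ-fromℚᵘ (ℚᵘ.mkℚᵘ (+ (a + b)) 0) ⟩
  ℚᵘ.mkℚᵘ (+ (a + b)) 0                ≈⟨ ℚᵘ.*≡* (cong (ℤ._* + 1) (cong₂ ℤ._+_ (sym (ℤ.*-identityʳ (+ a))) (sym (ℤ.*-identityʳ (+ b))))) ⟩
  ℚᵘ.mkℚᵘ (+ a) 0 ℚᵘ.+ ℚᵘ.mkℚᵘ (+ b) 0  ≈⟨ ℚᵘ.+-cong (ℚ.toℚᵘ-fromℚᵘ (ℚᵘ.mkℚᵘ (+ a) 0)) (ℚ.toℚᵘ-fromℚᵘ (ℚᵘ.mkℚᵘ (+ b) 0)) ⟨
  toℚᵘ (ι a) ℚᵘ.+ toℚᵘ (ι b)           ≈⟨ ℚ.toℚᵘ-homo-+ (ι a) (ι b) ⟨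
  toℚᵘ (ι a ℚ.+ ι b)                   ∎)
  where open import Relation.Binary.Reasoning.Setoid ℚᵘ.≃-setoid

/-*-/ : ∀ a b c d .{{_ : NonZero b}} .{{_ : NonZero d}} .{{_ : NonZero (b * d)}} →
        (+ a ℚ./ b) ℚ.* (+ c ℚ./ d) ≡ + (a * c) ℚ./ (b * d)
/-*-/ a (suc b) c (suc d) = ℚ.toℚᵘ-injective (begin
  toℚᵘ ((+ a ℚ./ suc b) ℚ.* (+ c ℚ./ suc d))         ≈⟨ ℚ.toℚᵘ-homo-* (+ a ℚ./ suc b) (+ c ℚ./ suc d) ⟩
  toℚᵘ (+ a ℚ./ suc b) ℚᵘ.* toℚᵘ (+ c ℚ./ suc d)     ≈⟨ ℚᵘ.*-cong (ℚ.toℚᵘ-fromℚᵘ (ℚᵘ.mkℚᵘ (+ a) b)) (ℚ.toℚᵘ-fromℚᵘ (ℚᵘ.mkℚᵘ (+ c) d)) ⟩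
  ℚᵘ.mkℚᵘ (+ a) b ℚᵘ.* ℚᵘ.mkℚᵘ (+ c) d               ≈⟨ ℚᵘ.*≡* (cong (ℤ._* + (suc b * suc d)) (sym (ℤ.pos-* a c))) ⟩
  ℚᵘ.mkℚᵘ (+ (a * c)) (d + b * suc d)                ≈⟨ ℚ.toℚᵘ-fromℚᵘ (ℚᵘ.mkℚᵘ (+ (a * c)) (d + b * suc d)) ⟨
  toℚᵘ (+ (a * c) ℚ./ (suc b * suc d))               ∎)
  where open import Relation.Binary.Reasoning.Setoid ℚᵘ.≃-setoid

ι-homo-* : ∀ a b → ι (a * b) ≡ ι a ℚ.* ι b
ι-homo-* a b = sym (/-*-/ a 1 b 1)

ι-homo-^ : ∀ a m → ι (a ^ m) ≡ ι a ^ℚ m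
ι-homo-^ a zero    = refl
ι-homo-^ a (suc m) = trans (ι-homo-* a (a ^ m)) (cong (ι a ℚ.*_) (ι-homo-^ a m))

ι-*-1/ : ∀ a d .{{_ : NonZero d}} → ι (d * a) ℚ.* (+ 1 ℚ./ d) ≡ ι a
ι-*-1/ a d@(suc _) = trans (/-*-/ (d * a) 1 1 d) (ℚ.≤-antisym
  (/-mono-cross-≤ {d * a * 1} {1 * d} {a} {1} (≤-reflexive eq))
  (/-mono-cross-≤ {a} {1} {d * a * 1} {1 * d} (≤-reflexive (sym eq))))
  where
  eq : d * a * 1 * 1 ≡ a * (1 * d)
  eq = solve 2 (λ d a → d :* a :* con 1 :* con 1 := a :* (con 1 :* d)) refl d a
    where open +-*-Solver

*-mono-nonNeg : ∀ {p q r s} → 0ℚ ℚ.≤ r → 0ℚ ℚ.≤ q → p ℚ.≤ q → r ℚ.≤ s → p ℚ.* r ℚ.≤ q ℚ.* s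
*-mono-nonNeg {p} {q} {r} {s} 0≤r 0≤q p≤q r≤s = ℚ.≤-trans
  (ℚ.*-monoʳ-≤-nonNeg r {{ℚ.nonNegative 0≤r}} p≤q)
  (ℚ.*-monoˡ-≤-nonNeg q {{ℚ.nonNegative 0≤q}} r≤s)

^ℚ-nonNeg : ∀ {p} m → 0ℚ ℚ.≤ p → 0ℚ ℚ.≤ p ^ℚ m
^ℚ-nonNeg zero    0≤p = ℚ.nonNegative⁻¹ 1ℚ
^ℚ-nonNeg {p} (suc m) 0≤p = subst (ℚ._≤ p ^ℚ suc m) (ℚ.*-zeroˡ 0ℚ)
  (*-mono-nonNeg ℚ.≤-refl 0≤p 0≤p (^ℚ-nonNeg m 0≤p))

^ℚ-mono-≤ : ∀ {p q} m → 0ℚ ℚ.≤ p → p ℚ.≤ q → p ^ℚ m ℚ.≤ q ^ℚ m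
^ℚ-mono-≤ zero    0≤p p≤q = ℚ.≤-refl
^ℚ-mono-≤ (suc m) 0≤p p≤q =
  *-mono-nonNeg (^ℚ-nonNeg m 0≤p) (ℚ.≤-trans 0≤p p≤q) p≤q (^ℚ-mono-≤ m 0≤p p≤q)

^ℚ<1 : ∀ {p} m .{{_ : NonZero m}} → 0ℚ ℚ.≤ p → p ℚ.< 1ℚ → p ^ℚ m ℚ.< 1ℚ
^ℚ<1 {p} (suc m) 0≤p p<1 = begin-strict
  p ℚ.* p ^ℚ m   ≤⟨ ℚ.*-monoˡ-≤-nonNeg p {{ℚ.nonNegative 0≤p}} (^ℚ-mono-≤ m 0≤p (ℚ.<⇒≤ p<1)) ⟩
  p ℚ.* 1ℚ ^ℚ m  ≡⟨ cong (p ℚ.*_) (trans (sym (ι-homo-^ 1 m)) (cong ι (^-zeroˡ m))) ⟩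
  p ℚ.* 1ℚ       ≡⟨ ℚ.*-identityʳ p ⟩
  p              <⟨ p<1 ⟩
  1ℚ             ∎
  where open ℚ.≤-Reasoning

∣∣-≤ : ∀ {p b} → p ℚ.≤ b → ℚ.- b ℚ.≤ p → ℚ.∣ p ∣ ℚ.≤ b
∣∣-≤ {p} {b} p≤b -b≤p with ℚ.∣p∣≡p∨∣p∣≡-p p
... | inj₁ eq = subst (ℚ._≤ b) (sym eq) p≤b
... | inj₂ eq = subst₂ ℚ._≤_ (sym eq) (solve 1 (λ b → :- (:- b) := b) refl b) (ℚ.neg-antimono-≤ -b≤p)
  where open ℚSolver.+-*-Solver

p≤∣p∣ : ∀ p → p ℚ.≤ ℚ.∣ p ∣
p≤∣p∣ p with ℚ.≤-total 0ℚ p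
... | inj₁ 0≤p = ℚ.≤-reflexive (sym (ℚ.0≤p⇒∣p∣≡p 0≤p))
... | inj₂ p≤0 = ℚ.≤-trans p≤0 (ℚ.0≤∣p∣ p)

-- Absolute values are needed because the base of the power in the theorem may be negative, where
-- powers are not monotone.
∣^ℚ∣≤ : ∀ {p} D m → ℚ.∣ p ∣ ℚ.≤ ι D → ℚ.∣ p ^ℚ m ∣ ℚ.≤ ι (D ^ m)
∣^ℚ∣≤ D zero ∣p∣≤D = ℚ.≤-refl
∣^ℚ∣≤ {p} D (suc m) ∣p∣≤D = begin
  ℚ.∣ p ℚ.* p ^ℚ m ∣          ≡⟨ ℚ.∣p*q∣≡∣p∣*∣q∣ p (p ^ℚ m) ⟩
  ℚ.∣ p ∣ ℚ.* ℚ.∣ p ^ℚ m ∣    ≤⟨ *-mono-nonNeg (ℚ.0≤∣p∣ (p ^ℚ m)) (0≤ι D) ∣p∣≤D (∣^ℚ∣≤ D m ∣p∣≤D) ⟩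
  ι D ℚ.* ι (D ^ m)           ≡⟨ ι-homo-* D (D ^ m) ⟨
  ι (D * D ^ m)               ∎
  where open ℚ.≤-Reasoning

p-q≤r : ∀ {p q r} → p ℚ.≤ r ℚ.+ q → p ℚ.- q ℚ.≤ r
p-q≤r {p} {q} {r} p≤r+q = subst (p ℚ.- q ℚ.≤_)
  (solve 2 (λ r q → r :+ q :- q := r) refl r q) (ℚ.+-monoˡ-≤ (ℚ.- q) p≤r+q)
  where open ℚSolver.+-*-Solver

-- The tolerance q - 1 leaves p^m ≥ 1, which fails for 0 ≤ p < 1.
q≤p^m+[q-1]⇒1≤p : ∀ {p q} m .{{_ : NonZero m}} → 0ℚ ℚ.≤ p →
                  q ℚ.≤ p ^ℚ m ℚ.+ (q ℚ.- 1ℚ) → 1ℚ ℚ.≤ p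
q≤p^m+[q-1]⇒1≤p {p} {q} m 0≤p q≤ = ℚ.≮⇒≥ λ p<1 → ℚ.<-irrefl refl (begin-strict
  q                          ≤⟨ q≤ ⟩
  p ^ℚ m ℚ.+ (q ℚ.- 1ℚ)      <⟨ ℚ.+-monoˡ-< (q ℚ.- 1ℚ) (^ℚ<1 m 0≤p p<1) ⟩
  1ℚ ℚ.+ (q ℚ.- 1ℚ)          ≡⟨ solve 2 (λ o q → o :+ (q :- o) := q) refl 1ℚ q ⟩
  q                          ∎)
  where
  open ℚ.≤-Reasoning
  open ℚSolver.+-*-Solver

^ℚ-cancel-< : ∀ {p q} m → 0ℚ ℚ.≤ q → p ^ℚ m ℚ.< q ^ℚ m → p ℚ.< q
^ℚ-cancel-< m 0≤q p^m<q^m = ℚ.≰⇒> λ q≤p → ℚ.<-irrefl refl (ℚ.<-≤-trans p^m<q^m (^ℚ-mono-≤ m 0≤q q≤p))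

-- The m-th powers of the approximations converge to q by `root-^`; the error q - 1 is admissible
-- because it is positive.
1<q⇒1≤rootSeq : ∀ m .{{_ : NonZero m}} q 0≤q → 1ℚ ℚ.< q →
                ∃ λ N → ∀ i → N ≤ i → 1ℚ ℚ.≤ rootSeq m q 0≤q i
1<q⇒1≤rootSeq m q 0≤q 1<q = proj₁ root^m≥q , λ i N≤i →
  q≤p^m+[q-1]⇒1≤p m (rootSeq-nonNeg m q 0≤q i)
    (subst (λ z → q ℚ.≤ z ℚ.+ (q ℚ.- 1ℚ)) (seq-^ℝ (root m q 0≤q) m i) (proj₂ root^m≥q i N≤i))
  where
  0<q-1 : 0ℚ ℚ.< q ℚ.- 1ℚ
  0<q-1 = subst (ℚ._< q ℚ.- 1ℚ) (ℚ.+-inverseʳ 1ℚ) (ℚ.+-monoˡ-< (ℚ.- 1ℚ) 1<q)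

  root^m≥q : ∃ λ N → ∀ i → N ≤ i → q ℚ.≤ seq (root m q 0≤q ^ℝ m) i ℚ.+ (q ℚ.- 1ℚ)
  root^m≥q = proj₂ (root-^ m q 0≤q) (q ℚ.- 1ℚ) 0<q-1

-- The integer part of the root and the bound at rational approximations.

n<k*[1+n]^m : ∀ n k m .{{_ : NonZero k}} .{{_ : NonZero m}} → n < k * suc n ^ m
n<k*[1+n]^m n k (suc m) = begin-strict
  n                        <⟨ n<1+n n ⟩
  suc n                    ≤⟨ m≤m*n (suc n) (suc n ^ m) {{m^n≢0 (suc n) m}} ⟩
  suc n ^ suc m            ≤⟨ m≤n*m (suc n ^ suc m) k ⟩
  k * suc n ^ suc m        ∎
  where open ≤-Reasoning

-- The maximal value is returned as a successor, so that it can serve as a nonzero base for digit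
-- expansions.
floor-root : ∀ n k m .{{_ : NonZero k}} .{{_ : NonZero m}} → k ≤ n →
             ∃ λ b → k * suc b ^ m ≤ n × n < k * suc (suc b) ^ m
floor-root n k m@(suc _) k≤n
  -- The search starts at n + 1, where the product exceeds n.
  with greatest (λ b → k * b ^ m ≤? n) (subst (_≤ n) (sym (*-zeroʳ k)) z≤n) (suc n) (<⇒≱ (n<k*[1+n]^m n k m))
-- The value 0 is not maximal, since k · 1^m = k ≤ n.
... | zero  , _ , ¬P1 = contradiction (subst (_≤ n) (sym (trans (cong (k *_) (^-zeroˡ m)) (*-identityʳ k))) k≤n) ¬P1
... | suc b , P , ¬P  = b , P , ≰⇒> ¬P

-- Here b and k stand for the b − 1 and k − 1 of the header.
∣[ρ-k-1]/k∣≤ : ∀ k b .{{_ : NonZero k}} {ρ} → 1ℚ ℚ.≤ ρ → ρ ℚ.≤ ι (2 + b) →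
               ℚ.∣ (ρ ℚ.- ι (suc k)) ℚ.* (+ 1 ℚ./ k) ∣ ℚ.≤ ι (suc (b / k))
∣[ρ-k-1]/k∣≤ k b {ρ} 1≤ρ ρ≤b+2 = begin
  ℚ.∣ (ρ ℚ.- ι (suc k)) ℚ.* 1/k ∣              ≡⟨ ℚ.∣p*q∣≡∣p∣*∣q∣ (ρ ℚ.- ι (suc k)) 1/k ⟩
  ℚ.∣ ρ ℚ.- ι (suc k) ∣ ℚ.* ℚ.∣ 1/k ∣          ≡⟨ cong (ℚ.∣ ρ ℚ.- ι (suc k) ∣ ℚ.*_) (ℚ.0≤p⇒∣p∣≡p (0≤fraction 1 k)) ⟩
  ℚ.∣ ρ ℚ.- ι (suc k) ∣ ℚ.* 1/k                ≤⟨ ℚ.*-monoʳ-≤-nonNeg 1/k {{ℚ.nonNegative (0≤fraction 1 k)}} (∣∣-≤ upper lower) ⟩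
  ι (k * D) ℚ.* 1/k                            ≡⟨ ι-*-1/ D k ⟩
  ι D                                          ∎
  where
  open ℚ.≤-Reasoning
  D = suc (b / k)
  1/k = + 1 ℚ./ k

  b<kD : b < k * D
  b<kD = subst₂ _<_ (sym (m≡m%n+[m/n]*n b k)) (*-comm D k) (+-monoˡ-< (b / k * k) (m%n<n b k))

  -- From 1 ≤ k and b + 1 ≤ kD follows b + 2 ≤ k + kD.
  upper : ρ ℚ.- ι (suc k) ℚ.≤ ι (k * D)
  upper = p-q≤r (ℚ.≤-trans ρ≤b+2 (ℚ.≤-trans
    (ι-mono-≤ (+-mono-≤ (>-nonZero⁻¹ k) b<kD))
    (ℚ.≤-trans (ι-mono-≤ (≤-trans (≤-reflexive (+-comm k (k * D))) (+-monoʳ-≤ (k * D) (n≤1+n k))))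
      (ℚ.≤-reflexive (ι-homo-+ (k * D) (suc k))))))

  -- This covers a negative base: ρ ≥ 1 gives ρ - (k + 1) ≥ -k, and D ≥ 1.
  lower : ℚ.- ι (k * D) ℚ.≤ ρ ℚ.- ι (suc k)
  lower = ℚ.≤-trans (ℚ.neg-antimono-≤ (ι-mono-≤ (m≤m*n k D))) (begin
    ℚ.- ι k                    ≡⟨ solve 2 (λ o k → :- k := o :- (o :+ k)) refl 1ℚ (ι k) ⟩
    1ℚ ℚ.- (1ℚ ℚ.+ ι k)        ≡⟨ cong (λ z → 1ℚ ℚ.- z) (ι-homo-+ 1 k) ⟨
    1ℚ ℚ.- ι (suc k)           ≤⟨ ℚ.+-monoˡ-≤ (ℚ.- ι (suc k)) 1≤ρ ⟩
    ρ ℚ.- ι (suc k)            ∎)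
    where open ℚSolver.+-*-Solver

-- Maximality of the base `suc b` gives ρ < b + 2, so ∣x∣ ≤ h + 1 and the count in `D^l≤mBO`
-- applies. Treating each rational `ρ` separately keeps limits out of the argument.
scaled-power≤BO-suc : ∀ n k l {ρ} .{{_ : NonZero n}} .{{_ : NonZero k}} → suc k ≤ n →
  1ℚ ℚ.≤ ρ → ρ ^ℚ (2 + l) ℚ.≤ + n ℚ./ suc k →
  (+ 1 ℚ./ (2 + l)) ℚ.* ((ρ ℚ.- ι (suc k)) ℚ.* (+ 1 ℚ./ k)) ^ℚ l ℚ.≤ ι (BO (suc k) (ℤ/ n ℤ))
scaled-power≤BO-suc n k l {ρ} k<n 1≤ρ ρ^m≤n/k = bound (floor-root n (suc k) M k<n)
  where
  open ℚ.≤-Reasoning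
  M = 2 + l
  1/m = + 1 ℚ./ M
  L = BO (suc k) (ℤ/ n ℤ)
  x = (ρ ℚ.- ι (suc k)) ℚ.* (+ 1 ℚ./ k)

  bound : (∃ λ b → suc k * suc b ^ M ≤ n × n < suc k * suc (suc b) ^ M) → 1/m ℚ.* x ^ℚ l ℚ.≤ ι L
  bound (b , kb^m≤n , n<) = begin
    1/m ℚ.* x ^ℚ l       ≤⟨ ℚ.*-monoˡ-≤-nonNeg 1/m {{ℚ.nonNegative (0≤fraction 1 M)}} x^l≤mL ⟩
    1/m ℚ.* ι (M * L)    ≡⟨ ℚ.*-comm 1/m (ι (M * L)) ⟩
    ι (M * L) ℚ.* 1/m    ≡⟨ ι-*-1/ L M ⟩
    ι L                  ∎
    where
    -- The largest digit bound with kh ≤ b, that is, with kh below the base `suc b`.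
    h = b / k

    kh≤b : k * h ≤ b
    kh≤b = subst (_≤ b) (*-comm h k) (m/n*n≤m b k)

    n/k< : + n ℚ./ suc k ℚ.< ι (2 + b) ^ℚ M
    n/k< = subst (+ n ℚ./ suc k ℚ.<_) (ι-homo-^ (2 + b) M) (/-mono-cross-< {n} {suc k} {(2 + b) ^ M} {1}
      (subst₂ _<_ (sym (*-identityʳ n)) (*-comm (suc k) ((2 + b) ^ M)) n<))

    ρ≤b+2 : ρ ℚ.≤ ι (2 + b)
    ρ≤b+2 = ℚ.<⇒≤ (^ℚ-cancel-< M (0≤ι (2 + b)) (ℚ.≤-<-trans ρ^m≤n/k n/k<))

    x^l≤mL : x ^ℚ l ℚ.≤ ι (M * L)
    x^l≤mL = begin
      x ^ℚ l          ≤⟨ p≤∣p∣ (x ^ℚ l) ⟩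
      ℚ.∣ x ^ℚ l ∣    ≤⟨ ∣^ℚ∣≤ (suc h) l (∣[ρ-k-1]/k∣≤ k b 1≤ρ ρ≤b+2) ⟩
      ι (suc h ^ l)   ≤⟨ ι-mono-≤ (D^l≤mBO n (suc b) l h k (>-nonZero⁻¹ k) (s≤s kh≤b) kb^m≤n) ⟩
      ι (M * L)       ∎

-- Passage from rational approximations to Cauchy reals.

seq-minus : ∀ X Y i → seq (X -ℝ Y) i ≡ seq X i ℚ.- seq Y i
seq-minus X Y i = refl

seq-÷ : ∀ X d .{{_ : NonZero d}} i → seq (X ÷ℝ d) i ≡ seq X i ℚ.* (+ 1 ℚ./ d)
seq-÷ X d i = refl

seq-shift-scale : ∀ X a d .{{_ : NonZero d}} i →
                  seq ((X -ℝ fromℕ a) ÷ℝ d) i ≡ (seq X i ℚ.- ι a) ℚ.* (+ 1 ℚ./ d)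
seq-shift-scale X a d i = trans (seq-÷ (X -ℝ fromℕ a) d i)
  (cong (ℚ._* (+ 1 ℚ./ d)) (seq-minus X (fromℕ a) i))

-- The rational inequality holds without error from `N` on, so the same `N` serves every ε.
eventually-≤⇒≤ℝ : ∀ m .{{_ : NonZero m}} l L (Y : ℝ) →
  (∃ λ N → ∀ i → N ≤ i → (+ 1 ℚ./ m) ℚ.* seq Y i ^ℚ l ℚ.≤ ι L) →
  (fromℕ 1 ÷ℝ m) *ℝ Y ^ℝ l ≤ℝ fromℕ L
eventually-≤⇒≤ℝ m l L Y (N , bound) ε 0<ε = N , λ i N≤i → begin
  (ι 1 ℚ.* 1/m) ℚ.* seq (Y ^ℝ l) i   ≡⟨ cong (ℚ._* seq (Y ^ℝ l) i) (ℚ.*-identityˡ 1/m) ⟩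
  1/m ℚ.* seq (Y ^ℝ l) i             ≡⟨ cong (1/m ℚ.*_) (seq-^ℝ Y l i) ⟩
  1/m ℚ.* seq Y i ^ℚ l               ≤⟨ bound i N≤i ⟩
  ι L                                ≡⟨ ℚ.+-identityʳ (ι L) ⟨
  ι L ℚ.+ 0ℚ                         ≤⟨ ℚ.+-monoʳ-≤ (ι L) (ℚ.<⇒≤ 0<ε) ⟩
  ι L ℚ.+ ε                          ∎
  where
  open ℚ.≤-Reasoning
  1/m = + 1 ℚ./ m

eventually-≤⇒shift-scale-≤ℝ : ∀ m a d l L (X : ℝ) .{{_ : NonZero m}} .{{_ : NonZero d}} →
  (∃ λ N → ∀ i → N ≤ i → (+ 1 ℚ./ m) ℚ.* ((seq X i ℚ.- ι a) ℚ.* (+ 1 ℚ./ d)) ^ℚ l ℚ.≤ ι L) →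
  (fromℕ 1 ÷ℝ m) *ℝ ((X -ℝ fromℕ a) ÷ℝ d) ^ℝ l ≤ℝ fromℕ L
eventually-≤⇒shift-scale-≤ℝ m a d l L X (N , bound) = eventually-≤⇒≤ℝ m l L _
  (N , λ i N≤i → subst (λ z → (+ 1 ℚ./ m) ℚ.* z ^ℚ l ℚ.≤ ι L)
    (sym (seq-shift-scale X a d i)) (bound i N≤i))

-- Matching on successors turns the truncated differences k - 1 and m - 2 into the variables of the
-- preceding bound.
scaled-power≤BO : ∀ n k m {ρ} .{{_ : NonZero n}} .{{_ : NonZero k}} .{{_ : NonZero (k ∸ 1)}} .{{_ : NonZero m}} →
  2 ≤ m → k ≤ n → 1ℚ ℚ.≤ ρ → ρ ^ℚ m ℚ.≤ + n ℚ./ k →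
  (+ 1 ℚ./ m) ℚ.* ((ρ ℚ.- ι k) ℚ.* (+ 1 ℚ./ (k ∸ 1))) ^ℚ (m ∸ 2) ℚ.≤ ι (BO k (ℤ/ n ℤ))
scaled-power≤BO n (suc k) (suc (suc l)) {ρ} {{n≢0}} {{_}} {{k≢0}} (s≤s (s≤s _)) =
  scaled-power≤BO-suc n k l {ρ} {{n≢0}} {{k≢0}}

-- From here on instances are passed by name, so that types agree syntactically: otherwise
-- the type checker compares reals by unfolding their Cauchy moduli.
Behrend-bound : ∀ n k m (X : ℝ) .{{_ : NonZero n}} .{{_ : NonZero k}} .{{_ : NonZero (k ∸ 1)}} .{{_ : NonZero m}} →
  2 ≤ m → k ≤ n →
  (∃ λ N → ∀ i → N ≤ i → 1ℚ ℚ.≤ seq X i) → (∀ i → seq X i ^ℚ m ℚ.≤ + n ℚ./ k) →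
  (fromℕ 1 ÷ℝ m) *ℝ ((X -ℝ fromℕ k) ÷ℝ (k ∸ 1)) ^ℝ (m ∸ 2) ≤ℝ fromℕ (BO k (ℤ/ n ℤ))
Behrend-bound n k m X {{n≢0}} {{k≢0}} {{k-1≢0}} {{m≢0}} 2≤m k≤n (N , 1≤X) X^m≤n/k =
  eventually-≤⇒shift-scale-≤ℝ m k (k ∸ 1) (m ∸ 2) (BO k (ℤ/_ℤ n {{n≢0}})) X {{m≢0}} {{k-1≢0}}
    (N , λ i N≤i → scaled-power≤BO n k m {seq X i} {{n≢0}} {{k≢0}} {{k-1≢0}} {{m≢0}} 2≤m k≤n (1≤X i N≤i) (X^m≤n/k i))

-- The radicand is a variable for the same reason.
root-bound : ∀ n k m q (0≤q : 0ℚ ℚ.≤ q) .{{_ : NonZero n}} .{{_ : NonZero k}} .{{_ : NonZero (k ∸ 1)}} .{{_ : NonZero m}} →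
  2 ≤ m → k < n → q ≡ + n ℚ./ k →
  (fromℕ 1 ÷ℝ m) *ℝ ((root m q 0≤q -ℝ fromℕ k) ÷ℝ (k ∸ 1)) ^ℝ (m ∸ 2) ≤ℝ fromℕ (BO k (ℤ/ n ℤ))
root-bound n k m q 0≤q {{n≢0}} {{k≢0}} {{k-1≢0}} {{m≢0}} 2≤m k<n q≡n/k =
  Behrend-bound n k m (root m {{m≢0}} q 0≤q) {{n≢0}} {{k≢0}} {{k-1≢0}} {{m≢0}} 2≤m (<⇒≤ k<n)
    (1<q⇒1≤rootSeq m {{m≢0}} q 0≤q (subst (1ℚ ℚ.<_) (sym q≡n/k) 1<n/k))
    (λ i → subst (rootSeq m {{m≢0}} q 0≤q i ^ℚ m ℚ.≤_) q≡n/k (rootSeq-lower m {{m≢0}} q 0≤q i))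
  where
  1<n/k : 1ℚ ℚ.< ℚ._/_ (+ n) k {{k≢0}}
  1<n/k = /-mono-cross-< {1} {1} {n} {k} {{_}} {{k≢0}} (subst₂ _<_ (sym (*-identityˡ k)) (sym (*-identityʳ n)) k<n)

mainTheorem10 : ∀ (n k : ℕ) .{{_ : NonZero n}} .{{_ : NonZero k}} .{{_ : NonZero (k ∸ 1)}} →
    6 ≤ n → 3 ≤ k → k ≤ n ∸ 3 →
    ∀ (m : ℕ) .{{_ : NonZero m}} → 2 ≤ m →
    (fromℕ 1 ÷ℝ m) *ℝ ((root m ((+ n) ℚ./ k) (0≤fraction n k) -ℝ fromℕ k) ÷ℝ (k ∸ 1)) ^ℝ (m ∸ 2)
    ≤ℝ fromℕ (BO k (ℤ/ n ℤ))
mainTheorem10 n k {{n≢0}} {{k≢0}} {{k-1≢0}} 6≤n 3≤k k≤n∸3 m {{m≢0}} 2≤m =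
  root-bound n k m (ℚ._/_ (+ n) k {{k≢0}}) (0≤fraction n k {{k≢0}}) {{n≢0}} {{k≢0}} {{k-1≢0}} {{m≢0}} 2≤m k<n refl
  where
  k<n : k < n
  -- Subtracting 3 decreases n strictly because 3 ≤ n.
  k<n = ≤-<-trans k≤n∸3 (∸-monoʳ-< (s≤s z≤n) (≤-trans (s≤s (s≤s (s≤s z≤n))) 6≤n))
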